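{- Let $T$ be a tree and let $L$ be its set of leaves. Then $\gamma_{11}(T)=2\gamma(T)-1$ if and only if the following conditions hold: 1. the set $S$ of strong support vertices of $T$ is an independent dominating set; 2. any connected component $C$ of $T-(S\cup L)$ satisfies $|N(V(C))\cap S|=|V(C)|+1$, that is, every vertex in $C$ has exactly one neighbor in $S$ except one vertex that has two neighbors in $S$.
   Context: All graphs are finite, undirected, simple and connected; a tree is a connected acyclic graph. A leaf is a vertex of degree $1$. A support vertex is a vertex having at least one leaf in its neighborhood; a strong support vertex is a support vertex adjacent to at least two leaves. For a vertex set $X$, $N(X)$ denotes the set of all neighbors of the vertices of $X$. A set $S$ of vertices is a dominating set if every vertex not in $S$ is adjacent to at least one vertex of $S$; $\gamma(T)$ is the minimum cardinality of a dominating set of $T$. A perfect dominating set is a set $S$ of vertices such that every vertex not in $S$ is adjacent to exactly one vertex of $S$; $\gamma_{11}(T)$ is the minimum cardinality of a perfect dominating set of $T$.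
   Formalization: The tree is assumed to have at least three vertices; for the trees on one or two vertices the claim as printed fails, since γ₁₁ = γ = 1 = 2γ − 1 while there are no strong support vertices, so S is empty and not dominating. -}

module Defs where

open import Data.Fin.Base using (Fin)
open import Data.Fin.Properties using (any?; all?)
open import Data.Fin.Subset
  using (Subset; _∈_; _∉_; _⊆_; ⊤; ∁; _∩_; _∪_; ∣_∣; Nonempty)
open import Data.Fin.Subset.Properties using (_∈?_; anySubset?; ∈⊤)
open import Data.List.Base using (List; []; _∷_; _++_; length)
open import Data.List.Relation.Unary.Linked using (Linked)
open import Data.List.Relation.Unary.Unique.Propositional using (Unique)
open import Data.Nat.Base using (ℕ; _+_; _≤_; _<_)
open import Data.Nat.Induction using (<-wellFounded)
open import Data.Nat.Properties using (_≟_; _≤?_; _<?_; ≮⇒≥)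
open import Data.Product.Base using (_×_; _,_; ∃; ∃-syntax; proj₁; proj₂)
open import Data.Vec.Base using (tabulate)
open import Function.Base using (_∘_)
open import Induction.WellFounded using (Acc; acc)
open import Level using (0ℓ)
open import Relation.Binary.Construct.Closure.ReflexiveTransitive using (Star)
open import Relation.Binary.Core using (Rel)
open import Relation.Binary.Definitions using (Irreflexive; Symmetric)
  renaming (Decidable to Decidable₂)
open import Relation.Binary.PropositionalEquality using (_≡_; _≢_; refl)
open import Relation.Nullary.Decidable using (does; yes; no; _×-dec_; _→-dec_; ¬?)
open import Relation.Nullary.Negation using (¬_; contradiction)
open import Relation.Unary using (Pred; Decidable)

setOf : ∀ {n} {P : Pred (Fin n) 0ℓ} → Decidable P → Subset n
setOf P? = tabulate (does ∘ P?)

IsMinimumCardinality : ∀ {n} → Pred (Subset n) 0ℓ → ℕ → Set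
IsMinimumCardinality P k =
  (∃[ X ] P X × ∣ X ∣ ≡ k) × (∀ X → P X → k ≤ ∣ X ∣)

minimumCardinality : ∀ {n} {P : Pred (Subset n) 0ℓ} →
                     Decidable P → ∃ P → ∃ (IsMinimumCardinality P)
minimumCardinality {P = P} P? (X₀ , PX₀) = go X₀ PX₀ (<-wellFounded _)
  where
  go : ∀ X → P X → Acc _<_ ∣ X ∣ → ∃ (IsMinimumCardinality P)
  go X PX (acc rec) with anySubset? (λ Y → P? Y ×-dec (∣ Y ∣ <? ∣ X ∣))
  ... | yes (Y , PY , Y<X) = go Y PY (rec Y<X)
  ... | no ¬smaller =
    ∣ X ∣ , (X , PX , refl) , λ Y PY → ≮⇒≥ (λ Y<X → ¬smaller (Y , PY , Y<X))

record Graph (n : ℕ) : Set₁ where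
  infix 4 _~_ _~?_
  field
    _~_    : Rel (Fin n) 0ℓ
    _~?_   : Decidable₂ _~_
    irrefl : Irreflexive _≡_ _~_
    sym    : Symmetric _~_

module _ {n : ℕ} (G : Graph n) where
  open Graph G

  neighbours : Fin n → Subset n
  neighbours v = setOf (v ~?_)

  neighboursOf : Subset n → Subset n
  neighboursOf X = setOf (λ u → any? (λ v → (v ∈? X) ×-dec (v ~? u)))

  degree : Fin n → ℕ
  degree v = ∣ neighbours v ∣

  leaves : Subset n
  leaves = setOf (λ v → degree v ≟ 1)

  -- Having two leaf neighbours already makes a vertex a support vertex.
  strongSupports : Subset n
  strongSupports = setOf (λ v → 2 ≤? ∣ neighbours v ∩ leaves ∣)

  Independent : Subset n → Set
  Independent X = ∀ u v → u ∈ X → v ∈ X → ¬ (u ~ v)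

  Dominating : Subset n → Set
  Dominating X = ∀ v → v ∉ X → ∃[ u ] u ∈ X × v ~ u

  PerfectDominating : Subset n → Set
  PerfectDominating X = ∀ v → v ∉ X → ∣ neighbours v ∩ X ∣ ≡ 1

  dominating? : Decidable Dominating
  dominating? X = all? λ v →
    ¬? (v ∈? X) →-dec any? (λ u → (u ∈? X) ×-dec (v ~? u))

  perfectDominating? : Decidable PerfectDominating
  perfectDominating? X = all? λ v →
    ¬? (v ∈? X) →-dec (∣ neighbours v ∩ X ∣ ≟ 1)

  domination : ∃ (IsMinimumCardinality Dominating)
  domination = minimumCardinality dominating?
    (⊤ , λ v v∉⊤ → contradiction ∈⊤ v∉⊤)

  perfectDomination : ∃ (IsMinimumCardinality PerfectDominating)
  perfectDomination = minimumCardinality perfectDominating?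
    (⊤ , λ v v∉⊤ → contradiction ∈⊤ v∉⊤)

  γ : ℕ
  γ = proj₁ domination

  γ₁₁ : ℕ
  γ₁₁ = proj₁ perfectDomination

  AdjacentWithin : Subset n → Rel (Fin n) 0ℓ
  AdjacentWithin X u v = u ∈ X × v ∈ X × u ~ v

  -- The subgraph induced by X is connected; the empty graph is not.
  ConnectedSet : Subset n → Set
  ConnectedSet X =
    Nonempty X × (∀ u v → u ∈ X → v ∈ X → Star (AdjacentWithin X) u v)

  -- C is the vertex set of a connected component of the subgraph induced by W.
  IsComponent : Subset n → Subset n → Set
  IsComponent W C =
    C ⊆ W × ConnectedSet C ×
    (∀ D → D ⊆ W → ConnectedSet D → C ⊆ D → D ⊆ C)

  -- The cycle x, xs, x; simple graphs have only cycles of length at least 3.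
  IsCycle : Fin n → List (Fin n) → Set
  IsCycle x xs = 2 ≤ length xs × Unique (x ∷ xs) × Linked _~_ (x ∷ xs ++ x ∷ [])

  Acyclic : Set
  Acyclic = ∀ x xs → ¬ IsCycle x xs

  IsTree : Set
  IsTree = ConnectedSet ⊤ × Acyclic

  IsRemainingComponent : Subset n → Set
  IsRemainingComponent = IsComponent (∁ (strongSupports ∪ leaves))

  ComponentCount : Subset n → Set
  ComponentCount C = ∣ neighboursOf C ∩ strongSupports ∣ ≡ ∣ C ∣ + 1

  OneDoublyDominated : Subset n → Set
  OneDoublyDominated C =
    ∃[ v ] v ∈ C × ∣ neighbours v ∩ strongSupports ∣ ≡ 2 ×
      (∀ u → u ∈ C → u ≢ v → ∣ neighbours u ∩ strongSupports ∣ ≡ 1)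

  IndependentDominating : Subset n → Set
  IndependentDominating X = Independent X × Dominating X

{-# OPTIONS --safe #-}
module Submission where

-- Call a set closed if no vertex outside it has two neighbours in it.  In a forest, adding to
-- a dominating set D a vertex with two neighbours in the current set, as long as there is
-- one, adds at least two edges each time; since a forest on X has fewer than |X| edges, the
-- closure X of D has at most 2|D| − 1 vertices.  It is perfect dominating, so γ₁₁ ≤ 2γ − 1.
--
-- If equality holds, take D minimum and without leaves: D is independent, X induces a tree
-- with 2|X \ D| edges and consists of all non-leaves.  If some d ∈ D were not a strong
-- support vertex, let X′ be the closure of D \ {d}.  Counting edges shows that d ∉ X′ has no
-- neighbour in X′ and that every other vertex of X \ X′ has exactly one.  So X′ together
-- with one branch at d (its leaf, if it has one) is perfect dominating and smaller than X.
-- Hence D = S.  Every union Z of components of T − (S ∪ L) meets at least 2|Z| edges, because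
-- closing X \ Z gives X, and the total is 2|X \ S|, so each component C meets exactly 2|C|.
--
-- Conversely, a perfect dominating set contains S, hence the doubly dominated vertex of each
-- component, hence by propagation all non-leaves; counting the edges between non-leaves
-- shows that there are at least 2|S| − 1 of these.

open import Defs
open import Data.Bool.Base using (true; false; if_then_else_)
open import Data.Empty using (⊥; ⊥-elim)
open import Data.Fin.Base using (Fin; zero; suc; toℕ)
open import Data.Fin.Properties using (any?) renaming (_≟_ to _≟ᶠ_)
open import Data.Fin.Subset
  using (Subset; _∈_; _∉_; _⊆_; _⊃_; ⊤; ∁; _∩_; _∪_; ⁅_⁆; ∣_∣; Nonempty)
open import Data.Fin.Subset.Induction using (⊃-wellFounded)
open import Data.Fin.Subset.Properties
open import Data.List.Base using ([]; _∷_; _++_; length; take)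
open import Data.List.Membership.Propositional using () renaming (_∈_ to _∈ₗ_)
open import Data.List.Relation.Unary.All using ([]; _∷_)
open import Data.List.Relation.Unary.All.Properties using (¬Any⇒All¬)
open import Data.List.Relation.Unary.AllPairs using ([]; _∷_)
open import Data.List.Relation.Unary.Any using (here; there; index) renaming (any? to any?ₗ)
open import Data.List.Relation.Unary.Linked using (Linked; [-]; _∷_)
open import Data.List.Relation.Unary.Unique.Propositional using (Unique)
open import Data.List.Relation.Unary.Unique.Propositional.Properties using (take⁺)
open import Data.Nat.Base using (ℕ; zero; suc; _+_; _*_; _∸_; _≤_; _<_; z≤n; s≤s)
open import Data.Nat.Induction using (<-wellFounded)
open import Data.Nat.Properties
open import Data.Nat.Tactic.RingSolver using (solve-∀)
open import Data.Product.Base using (_×_; _,_; ∃-syntax; proj₁; proj₂)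
open import Data.Sum.Base using (inj₁; inj₂)
open import Data.Vec.Base using ([]; _∷_; lookup)
open import Data.Vec.Properties using (lookup∘tabulate; []=⇒lookup; lookup⇒[]=)
open import Function.Base using (_∘_; const; case_of_)
open import Function.Bundles using (_⇔_; mk⇔; Equivalence)
open import Induction.WellFounded using (Acc; acc)
open import Level using (0ℓ)
open import Relation.Binary.Construct.Closure.ReflexiveTransitive as Star
  using (Star; ε; _◅_; _◅◅_; reverse)
open import Relation.Binary.PropositionalEquality
open import Relation.Nullary using (¬_; Dec; yes; no; does; contradiction)
open import Relation.Nullary.Decidable using (dec-true; _×-dec_; ¬?)
open import Relation.Unary using (Pred; Decidable)

open import Algebra.Properties.CommutativeMonoid.Sum +-0-commutativeMonoid
  using (sum; ∑-comm; ∑-distrib-+; sum-cong-≗; sum-replicate-zero)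

-- Subsets, indicator functions and sums over subsets.

private
  variable
    n : ℕ

-- Linear inequalities are settled by exhibiting the certificate a + R ≤ b + L.
linear : ∀ {L R} a b → L ≤ R → a + R ≤ b + L → a ≤ b
linear {L} {R} a b L≤R h =
  +-cancelʳ-≤ R a b (≤-trans h (+-monoʳ-≤ b L≤R))

∈-setOf⁺ : {P : Pred (Fin n) 0ℓ} (P? : Decidable P) {v : Fin n} → P v → v ∈ setOf P?
∈-setOf⁺ P? {v} Pv =
  lookup⇒[]= v _ (trans (lookup∘tabulate (does ∘ P?) v) (dec-true (P? v) Pv))

∈-setOf⁻ : {P : Pred (Fin n) 0ℓ} (P? : Decidable P) {v : Fin n} → v ∈ setOf P? → P v
∈-setOf⁻ P? {v} v∈ with P? v | trans (sym (lookup∘tabulate (does ∘ P?) v)) ([]=⇒lookup v∈)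
... | yes Pv | _ = Pv

Disjoint : Subset n → Subset n → Set
Disjoint X Y = ∀ {v} → v ∈ X → v ∉ Y

infixl 6 _∖_
_∖_ : Subset n → Subset n → Subset n
X ∖ Y = X ∩ ∁ Y

∖⁺ : ∀ {X Y : Subset n} {v} → v ∈ X → v ∉ Y → v ∈ X ∖ Y
∖⁺ v∈X v∉Y = x∈p∩q⁺ (v∈X , x∉p⇒x∈∁p v∉Y)

∖⁻ : ∀ (X Y : Subset n) {v} → v ∈ X ∖ Y → v ∈ X × v ∉ Y
∖⁻ X Y v∈ with x∈p∩q⁻ X (∁ Y) v∈
... | v∈X , v∈∁Y = v∈X , x∈∁p⇒x∉p v∈∁Y

∪-∖ : ∀ {X Y : Subset n} → Y ⊆ X → Y ∪ (X ∖ Y) ≡ X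
∪-∖ {X = X} {Y} Y⊆X = ⊆-antisym to from
  where
  to : Y ∪ (X ∖ Y) ⊆ X
  to v∈ with x∈p∪q⁻ Y (X ∖ Y) v∈
  ... | inj₁ v∈Y = Y⊆X v∈Y
  ... | inj₂ v∈  = proj₁ (∖⁻ X Y v∈)

  from : X ⊆ Y ∪ (X ∖ Y)
  from {v} v∈X with v ∈? Y
  ... | yes v∈Y = x∈p∪q⁺ (inj₁ v∈Y)
  ... | no  v∉Y = x∈p∪q⁺ (inj₂ (∖⁺ v∈X v∉Y))

⁅⁆⊆ : ∀ {X : Subset n} {v} → v ∈ X → ⁅ v ⁆ ⊆ X
⁅⁆⊆ {X = X} v∈X u∈ = subst (_∈ X) (sym (x∈⁅y⁆⇒x≡y _ u∈)) v∈X

-- Membership as a number turns cardinalities and edge counts into sums over all of `Fin n`, where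
-- the order of summation can be exchanged.
χ : Subset n → Fin n → ℕ
χ X v = if lookup X v then 1 else 0

χ-∈ : ∀ {X : Subset n} {v} → v ∈ X → χ X v ≡ 1
χ-∈ v∈X rewrite []=⇒lookup v∈X = refl

χ-∉ : ∀ {X : Subset n} {v} → v ∉ X → χ X v ≡ 0
χ-∉ {X = X} {v} v∉X with lookup X v in eq
... | false = refl
... | true  = contradiction (lookup⇒[]= v X eq) v∉X

χ-∪ : ∀ {X Y : Subset n} → Disjoint X Y → ∀ v → χ (X ∪ Y) v ≡ χ X v + χ Y v
χ-∪ {X = X} {Y} dis v with v ∈? X | v ∈? Y
... | yes v∈X | yes v∈Y = contradiction v∈Y (dis v∈X)
... | yes v∈X | no  v∉Y = trans (χ-∈ (x∈p∪q⁺ (inj₁ v∈X)))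
  (sym (cong₂ _+_ (χ-∈ v∈X) (χ-∉ v∉Y)))
... | no  v∉X | yes v∈Y = trans (χ-∈ (x∈p∪q⁺ {p = X} (inj₂ v∈Y)))
  (sym (cong₂ _+_ (χ-∉ v∉X) (χ-∈ v∈Y)))
... | no  v∉X | no  v∉Y = trans
  (χ-∉ (λ v∈ → case x∈p∪q⁻ X Y v∈ of λ
    { (inj₁ v∈X) → v∉X v∈X ; (inj₂ v∈Y) → v∉Y v∈Y }))
  (sym (cong₂ _+_ (χ-∉ v∉X) (χ-∉ v∉Y)))

χ-∩ : ∀ (X Y : Subset n) v → χ (X ∩ Y) v ≡ χ X v * χ Y v
χ-∩ X Y v with v ∈? X | v ∈? Y
... | yes v∈X | yes v∈Y = trans (χ-∈ (x∈p∩q⁺ (v∈X , v∈Y)))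
  (sym (cong₂ _*_ (χ-∈ v∈X) (χ-∈ v∈Y)))
... | yes v∈X | no  v∉Y = trans (χ-∉ (v∉Y ∘ proj₂ ∘ x∈p∩q⁻ X Y))
  (sym (cong₂ _*_ (χ-∈ v∈X) (χ-∉ v∉Y)))
... | no  v∉X | _       = trans (χ-∉ (v∉X ∘ proj₁ ∘ x∈p∩q⁻ X Y))
  (sym (cong (_* χ Y v) (χ-∉ v∉X)))

∑∈ : Subset n → (Fin n → ℕ) → ℕ
∑∈ X f = sum (λ v → χ X v * f v)

sum-mono : ∀ {f g : Fin n → ℕ} → (∀ v → f v ≤ g v) → sum f ≤ sum g
sum-mono {zero}  f≤g = z≤n
sum-mono {suc n} f≤g = +-mono-≤ (f≤g zero) (sum-mono (f≤g ∘ suc))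

sum-*ˡ : ∀ k (f : Fin n → ℕ) → sum (λ v → k * f v) ≡ k * sum f
sum-*ˡ {zero}  k f = sym (*-zeroʳ k)
sum-*ˡ {suc n} k f = trans (cong (k * f zero +_) (sum-*ˡ k (f ∘ suc)))
  (sym (*-distribˡ-+ k (f zero) _))

∑∈-mono : ∀ (X : Subset n) {f g} → (∀ {v} → v ∈ X → f v ≤ g v) → ∑∈ X f ≤ ∑∈ X g
∑∈-mono X {f} {g} f≤g = sum-mono pointwise
  where
  pointwise : ∀ v → χ X v * f v ≤ χ X v * g v
  pointwise v with v ∈? X
  ... | yes v∈X = *-monoʳ-≤ (χ X v) (f≤g v∈X)
  ... | no  v∉X rewrite χ-∉ v∉X = z≤n

∑∈-cong : ∀ (X : Subset n) {f g} → (∀ {v} → v ∈ X → f v ≡ g v) → ∑∈ X f ≡ ∑∈ X g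
∑∈-cong X f≡g = ≤-antisym (∑∈-mono X (≤-reflexive ∘ f≡g))
                          (∑∈-mono X (≤-reflexive ∘ sym ∘ f≡g))

∑∈-∪ : ∀ {X Y : Subset n} f → Disjoint X Y → ∑∈ (X ∪ Y) f ≡ ∑∈ X f + ∑∈ Y f
∑∈-∪ {X = X} {Y} f dis = trans
  (sum-cong-≗ (λ v → trans (cong (_* f v) (χ-∪ dis v)) (*-distribʳ-+ (f v) (χ X v) (χ Y v))))
  (∑-distrib-+ (λ v → χ X v * f v) (λ v → χ Y v * f v))

∑∈-split : ∀ {X Y : Subset n} f → Y ⊆ X → ∑∈ X f ≡ ∑∈ Y f + ∑∈ (X ∖ Y) f
∑∈-split {X = X} {Y} f Y⊆X = trans (cong (λ Z → ∑∈ Z f) (sym (∪-∖ Y⊆X)))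
  (∑∈-∪ f (λ v∈Y v∈ → proj₂ (∖⁻ X Y v∈) v∈Y))

∑∈-+ : ∀ (X : Subset n) f g → ∑∈ X (λ v → f v + g v) ≡ ∑∈ X f + ∑∈ X g
∑∈-+ X f g = trans (sum-cong-≗ (λ v → *-distribˡ-+ (χ X v) (f v) (g v)))
  (∑-distrib-+ (λ v → χ X v * f v) (λ v → χ X v * g v))

∣∣≡sum : ∀ (X : Subset n) → ∣ X ∣ ≡ sum (χ X)
∣∣≡sum []          = refl
∣∣≡sum (true  ∷ X) = cong suc (∣∣≡sum X)
∣∣≡sum (false ∷ X) = ∣∣≡sum X

∣∣≡∑∈ : ∀ (X : Subset n) → ∣ X ∣ ≡ ∑∈ X (const 1)
∣∣≡∑∈ X = trans (∣∣≡sum X) (sum-cong-≗ (λ v → sym (*-identityʳ (χ X v))))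

∑∈-⁅⁆ : ∀ (v : Fin n) f → ∑∈ ⁅ v ⁆ f ≡ f v
∑∈-⁅⁆ {suc n} zero f = trans
  (cong₂ _+_ (*-identityˡ (f zero)) (trans (sum-cong-≗ (λ u → cong (_* f (suc u)) (χ-∉ {v = u} ∉⊥)))
    (sum-replicate-zero n)))
  (+-identityʳ (f zero))
∑∈-⁅⁆ {suc n} (suc v) f = ∑∈-⁅⁆ v (f ∘ suc)

∣∣-∪ : ∀ {X Y : Subset n} → Disjoint X Y → ∣ X ∪ Y ∣ ≡ ∣ X ∣ + ∣ Y ∣
∣∣-∪ {X = X} {Y} dis = trans (∣∣≡∑∈ (X ∪ Y))
  (trans (∑∈-∪ (const 1) dis) (sym (cong₂ _+_ (∣∣≡∑∈ X) (∣∣≡∑∈ Y))))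

∣∣-split : ∀ {X Y : Subset n} → Y ⊆ X → ∣ X ∣ ≡ ∣ Y ∣ + ∣ X ∖ Y ∣
∣∣-split {X = X} {Y} Y⊆X = trans (cong ∣_∣ (sym (∪-∖ Y⊆X)))
  (∣∣-∪ (λ v∈Y v∈ → proj₂ (∖⁻ X Y v∈) v∈Y))

∣∪⁅⁆∣ : ∀ {X : Subset n} {v} → v ∉ X → ∣ X ∪ ⁅ v ⁆ ∣ ≡ suc ∣ X ∣
∣∪⁅⁆∣ {X = X} {v} v∉X = trans
  (∣∣-∪ (λ u∈X u∈v → v∉X (subst (_∈ X) (x∈⁅y⁆⇒x≡y v u∈v) u∈X)))
  (trans (cong (∣ X ∣ +_) (∣⁅x⁆∣≡1 v)) (+-comm ∣ X ∣ 1))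

∣∖⁅⁆∣ : ∀ {X : Subset n} {v} → v ∈ X → ∣ X ∣ ≡ suc ∣ X ∖ ⁅ v ⁆ ∣
∣∖⁅⁆∣ {X = X} {v} v∈X = trans (∣∣-split (⁅⁆⊆ v∈X)) (cong (_+ ∣ X ∖ ⁅ v ⁆ ∣) (∣⁅x⁆∣≡1 v))

nonempty⇒∣∣≥1 : ∀ {X : Subset n} {v} → v ∈ X → 1 ≤ ∣ X ∣
nonempty⇒∣∣≥1 v∈X = subst (1 ≤_) (sym (∣∖⁅⁆∣ v∈X)) (s≤s z≤n)

∣∣≥1⇒nonempty : ∀ (X : Subset n) → 1 ≤ ∣ X ∣ → Nonempty X
∣∣≥1⇒nonempty {n} X h with nonempty? X
... | yes ne = ne
... | no  em = contradiction
  (subst (1 ≤_) (trans (cong ∣_∣ (Empty-unique em)) (∣⊥∣≡0 n)) h) λ ()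

∣∣≥2⇒other : ∀ (X : Subset n) → 2 ≤ ∣ X ∣ → ∀ v → ∃[ u ] u ∈ X × u ≢ v
∣∣≥2⇒other X h v with ∣∣≥1⇒nonempty (X ∖ ⁅ v ⁆) bound
  where
  bound : 1 ≤ ∣ X ∖ ⁅ v ⁆ ∣
  bound with v ∈? X
  ... | yes v∈X = ≤-pred (subst (2 ≤_) (∣∖⁅⁆∣ v∈X) h)
  ... | no  v∉X = ≤-trans (≤-trans (s≤s z≤n) h)
    (p⊆q⇒∣p∣≤∣q∣ (λ {u} u∈X → ∖⁺ u∈X (λ u∈v → v∉X (subst (_∈ X) (x∈⁅y⁆⇒x≡y v u∈v) u∈X))))
... | u , u∈ with ∖⁻ X ⁅ v ⁆ u∈
... | u∈X , u∉v = u , u∈X , x∉⁅y⁆⇒x≢y u∉v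

distinct⇒∣∣≥2 : ∀ {X : Subset n} {u v} → u ∈ X → v ∈ X → u ≢ v → 2 ≤ ∣ X ∣
distinct⇒∣∣≥2 {X = X} u∈X v∈X u≢v = subst (2 ≤_) (sym (∣∖⁅⁆∣ v∈X))
  (s≤s (nonempty⇒∣∣≥1 (∖⁺ u∈X (x≢y⇒x∉⁅y⁆ u≢v))))

∣∣≤1⇒unique : ∀ {X : Subset n} {u v} → ∣ X ∣ ≤ 1 → u ∈ X → v ∈ X → u ≡ v
∣∣≤1⇒unique {u = u} {v} h u∈X v∈X with u ≟ᶠ v
... | yes u≡v = u≡v
... | no  u≢v = contradiction (≤-trans (distinct⇒∣∣≥2 u∈X v∈X u≢v) h) λ { (s≤s ()) }

∑∈-⁅⁆-split : ∀ (X : Subset n) f {v} → v ∈ X → ∑∈ X f ≡ f v + ∑∈ (X ∖ ⁅ v ⁆) f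
∑∈-⁅⁆-split X f {v} v∈X = trans (∑∈-split f (⁅⁆⊆ v∈X)) (cong (_+ ∑∈ (X ∖ ⁅ v ⁆) f) (∑∈-⁅⁆ v f))

∑∈≤∣∣ : ∀ (X : Subset n) f → (∀ {v} → v ∈ X → f v ≤ 1) → ∑∈ X f ≤ ∣ X ∣
∑∈≤∣∣ X f h = subst (∑∈ X f ≤_) (sym (∣∣≡∑∈ X)) (∑∈-mono X h)

∑∈≥∣∣ : ∀ (X : Subset n) f → (∀ {v} → v ∈ X → 1 ≤ f v) → ∣ X ∣ ≤ ∑∈ X f
∑∈≥∣∣ X f h = subst (_≤ ∑∈ X f) (sym (∣∣≡∑∈ X)) (∑∈-mono X h)

-- The other summands contribute at most `∣ X ∣` - 1, so the bound on the total leaves at least one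
-- for `f v`.
∑∈≥∣∣⇒≥1 : ∀ (X : Subset n) f → (∀ {v} → v ∈ X → f v ≤ 1) → ∣ X ∣ ≤ ∑∈ X f →
           ∀ {v} → v ∈ X → 1 ≤ f v
∑∈≥∣∣⇒≥1 X f f≤1 h {v} v∈X = +-cancelʳ-≤ _ 1 (f v)
  (≤-trans (≤-reflexive (sym (∣∖⁅⁆∣ v∈X)))
  (≤-trans h (≤-trans (≤-reflexive (∑∈-⁅⁆-split X f v∈X))
    (+-monoʳ-≤ (f v) (∑∈≤∣∣ (X ∖ ⁅ v ⁆) f (f≤1 ∘ proj₁ ∘ ∖⁻ X ⁅ v ⁆))))))

-- Dually, the other summands use up at least `∣ X ∣` - 1 of the total.
∑∈≤∣∣⇒≤1 : ∀ (X : Subset n) f → (∀ {v} → v ∈ X → 1 ≤ f v) → ∑∈ X f ≤ ∣ X ∣ →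
           ∀ {v} → v ∈ X → f v ≤ 1
∑∈≤∣∣⇒≤1 X f 1≤f h {v} v∈X = +-cancelʳ-≤ _ (f v) 1
  (≤-trans (+-monoʳ-≤ (f v) (∑∈≥∣∣ (X ∖ ⁅ v ⁆) f (1≤f ∘ proj₁ ∘ ∖⁻ X ⁅ v ⁆)))
  (≤-trans (≤-reflexive (sym (∑∈-⁅⁆-split X f v∈X)))
  (≤-trans h (≤-reflexive (∣∖⁅⁆∣ v∈X)))))

inImage? : ∀ (f : Fin n → Fin n) X → Decidable (λ u → ∃[ v ] v ∈ X × f v ≡ u)
inImage? f X u = any? (λ v → (v ∈? X) ×-dec (f v ≟ᶠ u))

image : (Fin n → Fin n) → Subset n → Subset n
image f X = setOf (inImage? f X)

∈-image⁺ : ∀ (f : Fin n → Fin n) {X u} → u ∈ X → f u ∈ image f X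
∈-image⁺ f {X} {u} u∈X = ∈-setOf⁺ (inImage? f X) (u , u∈X , refl)

∈-image⁻ : ∀ (f : Fin n → Fin n) {X u} → u ∈ image f X → ∃[ v ] v ∈ X × f v ≡ u
∈-image⁻ f {X} = ∈-setOf⁻ (inImage? f X)

-- Double counting of the pairs (u, v) with v ∈ X and `f v ≡ u`: each u in the image occurs at least
-- once, each v ∈ X exactly once.
∣image∣≤ : ∀ (f : Fin n → Fin n) X → ∣ image f X ∣ ≤ ∣ X ∣
∣image∣≤ {n} f X = begin
  ∣ image f X ∣                                      ≡⟨ ∣∣≡sum (image f X) ⟩
  sum (χ (image f X))                                ≤⟨ sum-mono pointwise ⟩
  sum (λ u → sum (λ v → χ X v * χ ⁅ f v ⁆ u))        ≡⟨ ∑-comm (λ u v → χ X v * χ ⁅ f v ⁆ u) ⟩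
  sum (λ v → sum (λ u → χ X v * χ ⁅ f v ⁆ u))        ≡⟨ sum-cong-≗ inner ⟩
  sum (χ X)                                          ≡⟨ sym (∣∣≡sum X) ⟩
  ∣ X ∣                                              ∎
  where
  open ≤-Reasoning
  inner : ∀ v → sum (λ u → χ X v * χ ⁅ f v ⁆ u) ≡ χ X v
  inner v = trans (sum-*ˡ (χ X v) (χ ⁅ f v ⁆))
    (trans (cong (χ X v *_) (trans (sym (∣∣≡sum ⁅ f v ⁆)) (∣⁅x⁆∣≡1 (f v)))) (*-identityʳ _))

  pointwise : ∀ u → χ (image f X) u ≤ sum (λ v → χ X v * χ ⁅ f v ⁆ u)
  pointwise u with u ∈? image f X
  ... | no  u∉ rewrite χ-∉ u∉ = z≤n
  ... | yes u∈ with ∈-image⁻ f u∈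
  ... | v , v∈X , fv≡u = ≤-trans
    (≤-reflexive (trans (χ-∈ u∈) (sym (χ-∈ (subst (u ∈_) (cong ⁅_⁆ (sym fv≡u)) (x∈⁅x⁆ u))))))
    (≤-trans (m≤m+n _ _) (≤-reflexive (sym (∑∈-⁅⁆-split X (λ v → χ ⁅ f v ⁆ u) v∈X))))

-- Degrees and edge counts in an arbitrary graph.

module GraphCounting {n : ℕ} (G : Graph n) where
  open Graph G renaming (sym to ~-sym; irrefl to ~-irrefl)

  N : Fin n → Subset n
  N = neighbours G

  ∈-N⁺ : ∀ {u v} → u ~ v → v ∈ N u
  ∈-N⁺ {u} = ∈-setOf⁺ (u ~?_)

  ∈-N⁻ : ∀ {u v} → v ∈ N u → u ~ v
  ∈-N⁻ {u} = ∈-setOf⁻ (u ~?_)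

  deg : Fin n → Subset n → ℕ
  deg v Y = ∣ N v ∩ Y ∣

  edges : Subset n → Subset n → ℕ
  edges X Y = ∑∈ X (λ v → deg v Y)

  -- Every edge inside X is counted twice.
  E : Subset n → ℕ
  E X = edges X X

  deg≥1 : ∀ {u v Y} → v ~ u → u ∈ Y → 1 ≤ deg v Y
  deg≥1 v~u u∈Y = nonempty⇒∣∣≥1 (x∈p∩q⁺ (∈-N⁺ v~u , u∈Y))

  deg≥2 : ∀ {u w v Y} → v ~ u → u ∈ Y → v ~ w → w ∈ Y → u ≢ w → 2 ≤ deg v Y
  deg≥2 v~u u∈Y v~w w∈Y =
    distinct⇒∣∣≥2 (x∈p∩q⁺ (∈-N⁺ v~u , u∈Y)) (x∈p∩q⁺ (∈-N⁺ v~w , w∈Y))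

  deg≥1⇒neighbour : ∀ {v} Y → 1 ≤ deg v Y → ∃[ u ] v ~ u × u ∈ Y
  deg≥1⇒neighbour {v} Y h with ∣∣≥1⇒nonempty (N v ∩ Y) h
  ... | u , u∈ with x∈p∩q⁻ (N v) Y u∈
  ... | u∈N , u∈Y = u , ∈-N⁻ u∈N , u∈Y

  deg≥2⇒other : ∀ {v} Y → 2 ≤ deg v Y → ∀ w → ∃[ u ] v ~ u × u ∈ Y × u ≢ w
  deg≥2⇒other {v} Y h w with ∣∣≥2⇒other (N v ∩ Y) h w
  ... | u , u∈ , u≢w with x∈p∩q⁻ (N v) Y u∈
  ... | u∈N , u∈Y = u , ∈-N⁻ u∈N , u∈Y , u≢w

  deg≤1⇒unique : ∀ {u w v Y} → deg v Y ≤ 1 → v ~ u → u ∈ Y → v ~ w → w ∈ Y → u ≡ w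
  deg≤1⇒unique h v~u u∈Y v~w w∈Y =
    ∣∣≤1⇒unique h (x∈p∩q⁺ (∈-N⁺ v~u , u∈Y)) (x∈p∩q⁺ (∈-N⁺ v~w , w∈Y))

  deg≡0 : ∀ {v} Y → (∀ {u} → v ~ u → u ∉ Y) → deg v Y ≡ 0
  deg≡0 Y h = n≤0⇒n≡0 (≮⇒≥ λ d → case deg≥1⇒neighbour Y d of λ
    (u , v~u , u∈Y) → h v~u u∈Y)

  deg≡0⇒∉ : ∀ {u v Y} → deg v Y ≡ 0 → v ~ u → u ∉ Y
  deg≡0⇒∉ h v~u u∈Y = contradiction (subst (1 ≤_) h (deg≥1 v~u u∈Y)) λ ()

  deg-mono : ∀ v {X Y} → X ⊆ Y → deg v X ≤ deg v Y
  deg-mono v {X} {Y} X⊆Y = p⊆q⇒∣p∣≤∣q∣ λ u∈ → case x∈p∩q⁻ (N v) X u∈ of λ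
    (u∈N , u∈X) → x∈p∩q⁺ (u∈N , X⊆Y u∈X)

  deg-∪ : ∀ v {X Y} → Disjoint X Y → deg v (X ∪ Y) ≡ deg v X + deg v Y
  deg-∪ v {X} {Y} dis = trans (cong ∣_∣ (∩-distribˡ-∪ (N v) X Y))
    (∣∣-∪ (λ u∈ u∈′ → dis (p∩q⊆q (N v) X u∈) (p∩q⊆q (N v) Y u∈′)))

  deg-split : ∀ v {X Y} → Y ⊆ X → deg v X ≡ deg v Y + deg v (X ∖ Y)
  deg-split v {X} {Y} Y⊆X = trans (cong (deg v) (sym (∪-∖ Y⊆X)))
    (deg-∪ v (λ v∈Y v∈ → proj₂ (∖⁻ X Y v∈) v∈Y))

  edges-splitʳ : ∀ Z {X Y} → Y ⊆ X → edges Z X ≡ edges Z Y + edges Z (X ∖ Y)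
  edges-splitʳ Z {X} {Y} Y⊆X = trans (∑∈-cong Z (λ {v} _ → deg-split v Y⊆X))
    (∑∈-+ Z (λ v → deg v Y) (λ v → deg v (X ∖ Y)))

  χ-N-comm : ∀ u v → χ (N u) v ≡ χ (N v) u
  χ-N-comm u v with u ~? v
  ... | yes u~v = trans (χ-∈ (∈-N⁺ u~v)) (sym (χ-∈ (∈-N⁺ (~-sym u~v))))
  ... | no  u≁v = trans (χ-∉ (u≁v ∘ ∈-N⁻)) (sym (χ-∉ (u≁v ∘ ~-sym ∘ ∈-N⁻)))

  -- Both sides count the adjacent pairs with one end in X and the other in Y; adjacency is
  -- symmetric and the two sums can be exchanged.
  edges-comm : ∀ X Y → edges X Y ≡ edges Y X
  edges-comm X Y = begin
    edges X Y
      ≡⟨ sum-cong-≗ (expand X Y) ⟩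
    sum (λ u → sum (λ v → χ X u * (χ (N u) v * χ Y v)))
      ≡⟨ ∑-comm (λ u v → χ X u * (χ (N u) v * χ Y v)) ⟩
    sum (λ v → sum (λ u → χ X u * (χ (N u) v * χ Y v)))
      ≡⟨ sum-cong-≗ (λ v → sum-cong-≗ (λ u → trans (cong (λ t → χ X u * (t * χ Y v)) (χ-N-comm u v))
           (swap (χ X u) (χ (N v) u) (χ Y v)))) ⟩
    sum (λ v → sum (λ u → χ Y v * (χ (N v) u * χ X u)))
      ≡⟨ sym (sum-cong-≗ (expand Y X)) ⟩
    edges Y X ∎
    where
    open ≡-Reasoning
    swap : ∀ a b c → a * (b * c) ≡ c * (b * a)
    swap = solve-∀

    expand : ∀ X Y u → χ X u * deg u Y ≡ sum (λ v → χ X u * (χ (N u) v * χ Y v))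
    expand X Y u = trans
      (cong (χ X u *_) (trans (∣∣≡sum (N u ∩ Y)) (sum-cong-≗ (χ-∩ (N u) Y))))
      (sym (sum-*ˡ (χ X u) (λ v → χ (N u) v * χ Y v)))

  -- Ordered adjacent pairs inside X are sorted by which ends lie in Y; the mixed ones occur in both
  -- orientations, hence the factor 2.
  E-split : ∀ {X Y} → Y ⊆ X → E X ≡ E Y + 2 * edges (X ∖ Y) Y + E (X ∖ Y)
  E-split {X} {Y} Y⊆X = begin
    edges X X                                   ≡⟨ ∑∈-split _ Y⊆X ⟩
    edges Y X + edges R X                       ≡⟨ cong₂ _+_ (edges-splitʳ Y Y⊆X) (edges-splitʳ R Y⊆X) ⟩
    (E Y + edges Y R) + (edges R Y + E R)       ≡⟨ cong (λ t → (E Y + t) + (edges R Y + E R)) (edges-comm Y R) ⟩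
    (E Y + edges R Y) + (edges R Y + E R)       ≡⟨ regroup (E Y) (edges R Y) (E R) ⟩
    E Y + 2 * edges R Y + E R                   ∎
    where
    open ≡-Reasoning
    R = X ∖ Y
    regroup : ∀ a b c → (a + b) + (b + c) ≡ a + 2 * b + c
    regroup = solve-∀

  E-∪ : ∀ {X Y} → Disjoint X Y → E (X ∪ Y) ≡ E X + 2 * edges Y X + E Y
  E-∪ {X} {Y} dis = trans (E-split {X ∪ Y} {X} (p⊆p∪q Y))
    (cong (λ Z → E X + 2 * edges Z X + E Z) (⊆-antisym to from))
    where
    to : (X ∪ Y) ∖ X ⊆ Y
    to v∈ with ∖⁻ (X ∪ Y) X v∈
    ... | v∈∪ , v∉X with x∈p∪q⁻ X Y v∈∪
    ... | inj₁ v∈X = contradiction v∈X v∉X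
    ... | inj₂ v∈Y = v∈Y

    from : Y ⊆ (X ∪ Y) ∖ X
    from v∈Y = ∖⁺ (q⊆p∪q X Y v∈Y) (λ v∈X → dis v∈X v∈Y)

  edges-⁅⁆ : ∀ v Y → edges ⁅ v ⁆ Y ≡ deg v Y
  edges-⁅⁆ v Y = ∑∈-⁅⁆ v (λ u → deg u Y)

  E-⁅⁆ : ∀ v → E ⁅ v ⁆ ≡ 0
  E-⁅⁆ v = trans (edges-⁅⁆ v ⁅ v ⁆)
    (deg≡0 ⁅ v ⁆ λ v~u u∈ → ~-irrefl (sym (x∈⁅y⁆⇒x≡y v u∈)) v~u)

  E-insert : ∀ {X v} → v ∉ X → E (X ∪ ⁅ v ⁆) ≡ E X + 2 * deg v X
  E-insert {X} {v} v∉X = trans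
    (E-∪ (λ u∈X u∈v → v∉X (subst (_∈ X) (x∈⁅y⁆⇒x≡y v u∈v) u∈X)))
    (trans (cong₂ (λ a b → E X + 2 * a + b) (edges-⁅⁆ v X) (E-⁅⁆ v)) (+-identityʳ _))

  E-remove : ∀ {X v} → v ∈ X → E X ≡ E (X ∖ ⁅ v ⁆) + 2 * deg v X
  E-remove {X} {v} v∈X = trans (E-split (⁅⁆⊆ v∈X))
    (trans (cong₂ (λ a b → a + 2 * b + E X′) (E-⁅⁆ v) (trans (edges-comm X′ ⁅ v ⁆) (edges-⁅⁆ v X′)))
    (trans (+-comm (2 * deg v X′) (E X′))
      -- There is no loop at v, so v has the same degree into X as into X without v.
      (cong (λ t → E X′ + 2 * t) (sym (trans (deg-split v (⁅⁆⊆ v∈X))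
        (cong (_+ deg v X′) (trans (sym (edges-⁅⁆ v ⁅ v ⁆)) (E-⁅⁆ v))))))))
    where X′ = X ∖ ⁅ v ⁆

  edges≡0 : ∀ X Y → (∀ {u v} → u ∈ X → v ∈ Y → ¬ (u ~ v)) → edges X Y ≡ 0
  edges≡0 X Y h = n≤0⇒n≡0 (≤-trans
    (∑∈-mono X (λ u∈X → ≤-reflexive (deg≡0 Y (λ u~v v∈Y → h u∈X v∈Y u~v))))
    (≤-reflexive (trans (sum-cong-≗ (λ u → *-zeroʳ (χ X u))) (sum-replicate-zero n))))

  -- Closed sets and closures.

  Closed : Subset n → Set
  Closed Z = ∀ {v} → v ∉ Z → deg v Z ≤ 1

  -- Each added vertex has two neighbours in the current set and so raises the doubled edge count
  -- `E` by at least 4. A closed superset of Y cannot avoid any added vertex, so the result is the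
  -- least closed set containing Y.
  closure : ∀ Y → ∃[ Z ] Y ⊆ Z × Closed Z × E Y + 4 * ∣ Z ∣ ≤ E Z + 4 * ∣ Y ∣ ×
                  (∀ {Z′} → Y ⊆ Z′ → Closed Z′ → Z ⊆ Z′)
  closure Y = go Y (⊃-wellFounded Y)
    where
    go : ∀ Y → Acc _⊃_ Y → ∃[ Z ] Y ⊆ Z × Closed Z × E Y + 4 * ∣ Z ∣ ≤ E Z + 4 * ∣ Y ∣ ×
                           (∀ {Z′} → Y ⊆ Z′ → Closed Z′ → Z ⊆ Z′)
    go Y (acc rec) with any? (λ v → ¬? (v ∈? Y) ×-dec (2 ≤? deg v Y))
    ... | no none = Y , (λ v∈Y → v∈Y) ,
          (λ {v} v∉Y → ≤-pred (≰⇒> λ h → none (v , v∉Y , h))) , ≤-refl , λ Y⊆Z′ _ → Y⊆Z′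
    ... | yes (v , v∉Y , h) with go (Y ∪ ⁅ v ⁆) (rec (p⊆p∪q ⁅ v ⁆ , v , q⊆p∪q Y _ (x∈⁅x⁆ v) , v∉Y))
    ... | Z , Y′⊆Z , Z-closed , count , least =
          Z , Y′⊆Z ∘ p⊆p∪q ⁅ v ⁆ , Z-closed , bound , λ {Z′} Y⊆Z′ Z′-closed → least (extend Y⊆Z′ Z′-closed) Z′-closed
      where
      bound : E Y + 4 * ∣ Z ∣ ≤ E Z + 4 * ∣ Y ∣
      bound = linear _ _ (+-mono-≤ count h+h) (≤-reflexive
        (trans (cong (λ t → E Y + 4 * ∣ Z ∣ + (E Z + 4 * t + 2 * deg v Y)) (∣∪⁅⁆∣ v∉Y))
        (trans (regroup (E Y) (∣ Z ∣) (E Z) (∣ Y ∣) (deg v Y))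
          (cong (λ t → E Z + 4 * ∣ Y ∣ + (t + 4 * ∣ Z ∣ + 4)) (sym (E-insert v∉Y))))))
        where
        h+h : 4 ≤ 2 * deg v Y
        h+h = *-monoʳ-≤ 2 h
        regroup : ∀ a b c d e → a + 4 * b + (c + 4 * suc d + 2 * e) ≡ c + 4 * d + (a + 2 * e + 4 * b + 4)
        regroup = solve-∀

      extend : ∀ {Z′} → Y ⊆ Z′ → Closed Z′ → Y ∪ ⁅ v ⁆ ⊆ Z′
      extend {Z′} Y⊆Z′ Z′-closed {u} u∈ with x∈p∪q⁻ Y ⁅ v ⁆ u∈
      ... | inj₁ u∈Y = Y⊆Z′ u∈Y
      ... | inj₂ u∈v with v ∈? Z′
      ... | yes v∈Z′ = ⁅⁆⊆ v∈Z′ u∈v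
      ... | no  v∉Z′ = contradiction (≤-trans (≤-trans h (deg-mono v Y⊆Z′)) (Z′-closed v∉Z′)) λ { (s≤s ()) }

  -- Components and connected sets.

  ClosedWithin : Subset n → Subset n → Set
  ClosedWithin Z C = ∀ {u v} → u ∈ C → v ∈ Z → u ~ v → v ∈ C

  -- A spanning tree of the component of v provides the edges.
  component : ∀ Z v → v ∈ Z →
    ∃[ C ] C ⊆ Z × v ∈ C × ConnectedSet G C × ClosedWithin Z C × 2 * ∣ C ∣ ≤ E C + 2
  component Z v v∈Z = go ⁅ v ⁆ (⁅⁆⊆ v∈Z) (x∈⁅x⁆ v)
      (λ u∈ → subst (Star _ v) (sym (x∈⁅y⁆⇒x≡y v u∈)) ε)
      (≤-trans (≤-reflexive (cong (2 *_) (∣⁅x⁆∣≡1 v))) (m≤n+m 2 _)) (⊃-wellFounded _)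
    where
    go : ∀ A → A ⊆ Z → v ∈ A → (∀ {u} → u ∈ A → Star (AdjacentWithin G A) v u) →
         2 * ∣ A ∣ ≤ E A + 2 → Acc _⊃_ A →
         ∃[ C ] C ⊆ Z × v ∈ C × ConnectedSet G C × ClosedWithin Z C × 2 * ∣ C ∣ ≤ E C + 2
    go A A⊆Z v∈A walk count (acc rec)
      with any? (λ w → (w ∈? Z) ×-dec ¬? (w ∈? A) ×-dec any? (λ u → (u ∈? A) ×-dec (u ~? w)))
    ... | no none = A , A⊆Z , v∈A , ((v , v∈A) , λ u w u∈A w∈A → reverse swap (walk u∈A) ◅◅ walk w∈A) ,
          closed , count
      where
      swap : ∀ {u w} → AdjacentWithin G A u w → AdjacentWithin G A w u
      swap (u∈A , w∈A , u~w) = w∈A , u∈A , ~-sym u~w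

      closed : ClosedWithin Z A
      closed {u} {w} u∈A w∈Z u~w with w ∈? A
      ... | yes w∈A = w∈A
      ... | no  w∉A = contradiction (w , w∈Z , w∉A , u , u∈A , u~w) none
    ... | yes (w , w∈Z , w∉A , u , u∈A , u~w) =
      go A′ A′⊆Z (A⊆A′ v∈A) walk′ bound (rec (A⊆A′ , w , w∈A′ , w∉A))
      where
      A′ : Subset n
      A′ = A ∪ ⁅ w ⁆

      A⊆A′ : A ⊆ A′
      A⊆A′ = p⊆p∪q ⁅ w ⁆

      w∈A′ : w ∈ A′
      w∈A′ = q⊆p∪q A _ (x∈⁅x⁆ w)

      A′⊆Z : A′ ⊆ Z
      A′⊆Z x∈ with x∈p∪q⁻ A ⁅ w ⁆ x∈
      ... | inj₁ x∈A = A⊆Z x∈A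
      ... | inj₂ x∈w = ⁅⁆⊆ w∈Z x∈w

      widen : ∀ {x} → x ∈ A → Star (AdjacentWithin G A′) v x
      widen x∈A = Star.map (λ (a , b , c) → A⊆A′ a , A⊆A′ b , c) (walk x∈A)

      walk′ : ∀ {x} → x ∈ A′ → Star (AdjacentWithin G A′) v x
      walk′ x∈ with x∈p∪q⁻ A ⁅ w ⁆ x∈
      ... | inj₁ x∈A = widen x∈A
      ... | inj₂ x∈w rewrite x∈⁅y⁆⇒x≡y w x∈w = widen u∈A ◅◅ (A⊆A′ u∈A , w∈A′ , u~w) ◅ ε

      bound : 2 * ∣ A′ ∣ ≤ E A′ + 2
      bound = subst₂ _≤_ (cong (2 *_) (sym (∣∪⁅⁆∣ w∉A))) (cong (_+ 2) (sym (E-insert w∉A)))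
        (linear _ _ (+-mono-≤ count (*-monoʳ-≤ 2 (deg≥1 (~-sym u~w) u∈A)))
          (≤-reflexive (regroup (∣ A ∣) (E A) (deg w A))))
        where
        regroup : ∀ a b c → 2 * suc a + (b + 2 + 2 * c) ≡ b + 2 * c + 2 + (2 * a + 2)
        regroup = solve-∀

  walk-stays : ∀ {Z C} → ClosedWithin Z C → ∀ {u v} → Star (AdjacentWithin G Z) u v → u ∈ C → v ∈ C
  walk-stays closed ε                       u∈C = u∈C
  walk-stays closed ((_ , w∈Z , u~w) ◅ ws) u∈C = walk-stays closed ws (closed u∈C w∈Z u~w)

  -- A walk inside C cannot leave the component found inside C, so this component is C itself and
  -- its spanning tree supplies the edges.
  connected⇒edges : ∀ {C} → ConnectedSet G C → 2 * ∣ C ∣ ≤ E C + 2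
  connected⇒edges {C} ((v , v∈C) , walk) with component C v v∈C
  ... | A , A⊆C , v∈A , _ , closed , count
    rewrite ⊆-antisym {i = C} {A} (λ {u} u∈C → walk-stays closed (walk v u v∈C u∈C) v∈A) A⊆C = count

-- Edge bounds in forests.

module Forest {n : ℕ} (G : Graph n) (acyclic : Acyclic G) where
  open Graph G renaming (sym to ~-sym; irrefl to ~-irrefl)
  open GraphCounting G

  -- Positions start at 0, so one element more than the index of w is taken: the prefix then ends in
  -- w, which is adjacent to v.
  linked-close : ∀ {x v w zs} (w∈zs : w ∈ₗ zs) → Linked _~_ (x ∷ zs) → w ~ v →
                 Linked _~_ (x ∷ take (suc (toℕ (index w∈zs))) zs ++ v ∷ [])
  linked-close (here refl)   (x~w ∷ _)  w~v = x~w ∷ w~v ∷ [-]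
  linked-close (there w∈zs) (x~z ∷ zs) w~v = x~z ∷ linked-close w∈zs zs w~v

  -- The path from v through p to w is closed by the edge from w to v. As w comes after p, the cycle
  -- has at least three vertices.
  chord⇒cycle : ∀ {v p w zs} → Unique (v ∷ p ∷ zs) → Linked _~_ (v ∷ p ∷ zs) →
                w ∈ₗ zs → w ~ v → ⊥
  chord⇒cycle {v} {p} {w} {zs} unique (v~p ∷ linked) w∈zs w~v =
    acyclic v (p ∷ take k zs) (s≤s (nonempty w∈zs) , take⁺ (2 + k) unique , v~p ∷ linked-close w∈zs linked w~v)
    where
    k = suc (toℕ (index w∈zs))

    nonempty : ∀ {zs} (w∈zs : w ∈ₗ zs) → 1 ≤ length (take (suc (toℕ (index w∈zs))) zs)
    nonempty (here _)  = s≤s z≤n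
    nonempty (there _) = s≤s z≤n

  -- With all degrees at least two, a simple path inside X could be extended forever.
  ¬minDegree2 : ∀ X → Nonempty X → ¬ (∀ {v} → v ∈ X → 2 ≤ deg v X)
  ¬minDegree2 X (v₀ , v₀∈X) deg≥2X with deg≥2⇒other X (deg≥2X v₀∈X) v₀
  ... | v₁ , v₀~v₁ , v₁∈X , v₁≢v₀ =
    extend v₁ v₀ [] v₁∈X ((v₁≢v₀ ∷ []) ∷ [] ∷ []) (~-sym v₀~v₁ ∷ [-])
      (⁅ v₁ ⁆ ∪ ⁅ v₀ ⁆) seen (⊃-wellFounded _)
    where
    seen : ∀ {u} → u ∈ ⁅ v₁ ⁆ ∪ ⁅ v₀ ⁆ → u ∈ₗ v₁ ∷ v₀ ∷ []
    seen u∈ with x∈p∪q⁻ ⁅ v₁ ⁆ ⁅ v₀ ⁆ u∈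
    ... | inj₁ u∈v₁ = here (x∈⁅y⁆⇒x≡y v₁ u∈v₁)
    ... | inj₂ u∈v₀ = there (here (x∈⁅y⁆⇒x≡y v₀ u∈v₀))

    -- V collects visited vertices for the sake of termination: a vertex w off the path is not in V,
    -- so V grows strictly.
    extend : ∀ v p zs → v ∈ X → Unique (v ∷ p ∷ zs) → Linked _~_ (v ∷ p ∷ zs) →
             ∀ V → (∀ {u} → u ∈ V → u ∈ₗ v ∷ p ∷ zs) → Acc _⊃_ V → ⊥
    extend v p zs v∈X unique linked V V⊆ (acc rec) with deg≥2⇒other X (deg≥2X v∈X) p
    ... | w , v~w , w∈X , w≢p with any?ₗ (w ≟ᶠ_) (v ∷ p ∷ zs)
    ... | yes (here w≡v)           = ~-irrefl (sym w≡v) v~w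
    ... | yes (there (here w≡p))   = w≢p w≡p
    ... | yes (there (there w∈zs)) = chord⇒cycle unique linked w∈zs (~-sym v~w)
    ... | no  w∉ = extend w v (p ∷ zs) w∈X (¬Any⇒All¬ _ w∉ ∷ unique) (~-sym v~w ∷ linked)
                     (V ∪ ⁅ w ⁆) V′⊆ (rec (p⊆p∪q ⁅ w ⁆ , w , q⊆p∪q V _ (x∈⁅x⁆ w) , w∉ ∘ V⊆))
      where
      V′⊆ : ∀ {u} → u ∈ V ∪ ⁅ w ⁆ → u ∈ₗ w ∷ v ∷ p ∷ zs
      V′⊆ u∈ with x∈p∪q⁻ V ⁅ w ⁆ u∈
      ... | inj₁ u∈V = there (V⊆ u∈V)
      ... | inj₂ u∈w = here (x∈⁅y⁆⇒x≡y w u∈w)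

  -- Induction on `∣ X ∣`: by `¬minDegree2` some vertex has at most one neighbour in X, and deleting
  -- it loses at most one edge.
  forest-edges : ∀ X → Nonempty X → E X + 2 ≤ 2 * ∣ X ∣
  forest-edges X = go X (<-wellFounded _)
    where
    go : ∀ X → Acc _<_ ∣ X ∣ → Nonempty X → E X + 2 ≤ 2 * ∣ X ∣
    go X (acc rec) ne with any? (λ v → (v ∈? X) ×-dec (deg v X ≤? 1))
    ... | no none = contradiction (λ {v} v∈X → ≰⇒> (λ h → none (v , v∈X , h))) (¬minDegree2 X ne)
    ... | yes (v , v∈X , h) with nonempty? (X ∖ ⁅ v ⁆)
    ... | no empty = subst₂ _≤_ (cong (_+ 2) (sym E≡0)) (cong (2 *_) (sym ∣X∣≡1)) ≤-refl
      where
      X≡v : X ≡ ⁅ v ⁆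
      X≡v = ⊆-antisym (λ {u} u∈X → case u ∈? ⁅ v ⁆ of λ
        { (yes u∈v) → u∈v ; (no u∉v) → contradiction (u , ∖⁺ u∈X u∉v) empty }) (⁅⁆⊆ v∈X)
      E≡0 : E X ≡ 0
      E≡0 = trans (cong E X≡v) (E-⁅⁆ v)
      ∣X∣≡1 : ∣ X ∣ ≡ 1
      ∣X∣≡1 = trans (cong ∣_∣ X≡v) (∣⁅x⁆∣≡1 v)
    ... | yes ne′ = subst₂ _≤_ (cong (_+ 2) (sym (E-remove v∈X))) (cong (2 *_) (sym (∣∖⁅⁆∣ v∈X)))
      (linear _ _ (+-mono-≤ (go (X ∖ ⁅ v ⁆) (rec (≤-reflexive (sym (∣∖⁅⁆∣ v∈X)))) ne′) (*-monoʳ-≤ 2 h))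
        (≤-reflexive (regroup (E (X ∖ ⁅ v ⁆)) (deg v X) (∣ X ∖ ⁅ v ⁆ ∣))))
      where
      regroup : ∀ a b c → a + 2 * b + 2 + (2 * c + 2) ≡ 2 * suc c + (a + 2 + 2 * b)
      regroup = solve-∀

  -- C already has at least `∣ C ∣` - 1 edges, while the forest on C with v has at most `∣ C ∣`,
  -- which leaves at most one edge at v.
  outside-connected : ∀ {C} → ConnectedSet G C → ∀ {v} → v ∉ C → deg v C ≤ 1
  outside-connected {C} conn {v} v∉C = *-cancelˡ-≤ 2
    (linear _ _ (+-mono-≤ (connected⇒edges conn)
        (subst₂ _≤_ (cong (_+ 2) (E-insert v∉C)) (cong (2 *_) (∣∪⁅⁆∣ v∉C))
          (forest-edges (C ∪ ⁅ v ⁆) (v , q⊆p∪q C _ (x∈⁅x⁆ v)))))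
      (≤-reflexive (regroup (E C) (deg v C) (∣ C ∣))))
    where
    regroup : ∀ a b c → 2 * b + (a + 2 + 2 * suc c) ≡ 2 + (2 * c + (a + 2 * b + 2))
    regroup = solve-∀

-- Leaves and strong support vertices of a tree.

module Tree {n : ℕ} (T : Graph n) (tree : IsTree T) (3≤n : 3 ≤ n) where
  open Graph T renaming (sym to ~-sym; irrefl to ~-irrefl)
  open GraphCounting T
  open Forest T (proj₂ tree)

  L S W : Subset n
  L = leaves T
  S = strongSupports T
  W = ∁ (S ∪ L)

  walk : ∀ u v → Star (AdjacentWithin T ⊤) u v
  walk u v = proj₂ (proj₁ tree) u v ∈⊤ ∈⊤

  -- With `3 ≤ n`, this gives every vertex a neighbour and keeps leaves from being adjacent.
  third : ∀ u v → ∃[ w ] w ≢ u × w ≢ v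
  third u v with ∣∣≥2⇒other (⊤ {n} ∖ ⁅ u ⁆)
      (≤-pred (subst (3 ≤_) (trans (sym (∣⊤∣≡n n)) (∣∖⁅⁆∣ {X = ⊤ {n}} {u} ∈⊤)) 3≤n)) v
  ... | w , w∈ , w≢v = w , x∉⁅y⁆⇒x≢y (proj₂ (∖⁻ ⊤ ⁅ u ⁆ w∈)) , w≢v

  opaque
    has-neighbour : ∀ v → ∃[ u ] v ~ u
    has-neighbour v = let (w , w≢v , _) = third v v in first-step (walk v w) w≢v
      where
      first-step : ∀ {w} → Star (AdjacentWithin T ⊤) v w → w ≢ v → ∃[ u ] v ~ u
      first-step ε                 w≢v = contradiction refl w≢v
      first-step ((_ , _ , v~u) ◅ _) _ = _ , v~u

  leaf-degree : ∀ {v} → v ∈ L → ∣ N v ∣ ≤ 1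
  leaf-degree {v} v∈L = ≤-reflexive (∈-setOf⁻ (λ u → degree T u ≟ 1) {v} v∈L)

  leaf-unique : ∀ {v u w} → v ∈ L → v ~ u → v ~ w → u ≡ w
  leaf-unique {v} v∈L v~u v~w = ∣∣≤1⇒unique {X = N v} (leaf-degree {v} v∈L) (∈-N⁺ v~u) (∈-N⁺ v~w)

  -- Two adjacent leaves would be closed under adjacency, so no walk could reach a third vertex.
  leaves-not-adjacent : ∀ {u v} → u ∈ L → v ∈ L → ¬ (u ~ v)
  leaves-not-adjacent {u} {v} u∈L v∈L u~v with third u v
  ... | w , w≢u , w≢v with x∈p∪q⁻ ⁅ u ⁆ ⁅ v ⁆
        (walk-stays closed (walk u w) (p⊆p∪q ⁅ v ⁆ (x∈⁅x⁆ u)))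
    where
    closed : ClosedWithin ⊤ (⁅ u ⁆ ∪ ⁅ v ⁆)
    closed {x} {y} x∈ _ x~y with x∈p∪q⁻ ⁅ u ⁆ ⁅ v ⁆ x∈
    ... | inj₁ x∈u rewrite x∈⁅y⁆⇒x≡y u x∈u | leaf-unique u∈L x~y u~v = q⊆p∪q ⁅ u ⁆ _ (x∈⁅x⁆ v)
    ... | inj₂ x∈v rewrite x∈⁅y⁆⇒x≡y v x∈v | leaf-unique v∈L x~y (~-sym u~v) = p⊆p∪q ⁅ v ⁆ (x∈⁅x⁆ u)
  ... | inj₁ w∈u = w≢u (x∈⁅y⁆⇒x≡y u w∈u)
  ... | inj₂ w∈v = w≢v (x∈⁅y⁆⇒x≡y v w∈v)

  nonleaf-degree : ∀ {v} → v ∉ L → 2 ≤ ∣ N v ∣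
  nonleaf-degree {v} v∉L = ≤∧≢⇒< (nonempty⇒∣∣≥1 {X = N v} (∈-N⁺ (proj₂ (has-neighbour v))))
    (λ 1≡ → v∉L (∈-setOf⁺ (λ u → degree T u ≟ 1) {v} (sym 1≡)))

  opaque
    nonleaf-other : ∀ {v} → v ∉ L → ∀ u → ∃[ w ] v ~ w × w ≢ u
    nonleaf-other {v} v∉L u =
      let (w , w∈N , w≢u) = ∣∣≥2⇒other (N v) (nonleaf-degree {v} v∉L) u in w , ∈-N⁻ w∈N , w≢u

  deg-leaf : ∀ {v} → v ∈ L → ∀ Y → deg v Y ≤ 1
  deg-leaf {v} v∈L Y = ≤-trans {deg v Y} {∣ N v ∣} {1} (∣p∩q∣≤∣p∣ (N v) Y) (leaf-degree {v} v∈L)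

  ∈-S⁺ : ∀ {v} → 2 ≤ deg v L → v ∈ S
  ∈-S⁺ {v} = ∈-setOf⁺ (λ u → 2 ≤? deg u L) {v}

  ∈-S⁻ : ∀ {v} → v ∈ S → 2 ≤ deg v L
  ∈-S⁻ {v} = ∈-setOf⁻ (λ u → 2 ≤? deg u L) {v}

  S∩L≡∅ : Disjoint S L
  S∩L≡∅ v∈S v∈L = contradiction (≤-trans (∈-S⁻ v∈S) (deg-leaf v∈L L)) λ { (s≤s ()) }

  ∈-W⁺ : ∀ {v} → v ∉ S → v ∉ L → v ∈ W
  ∈-W⁺ v∉S v∉L = x∉p⇒x∈∁p λ v∈ → case x∈p∪q⁻ S L v∈ of λ
    { (inj₁ v∈S) → v∉S v∈S ; (inj₂ v∈L) → v∉L v∈L }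

  W∩S≡∅ : Disjoint W S
  W∩S≡∅ v∈W v∈S = x∈∁p⇒x∉p v∈W (p⊆p∪q L v∈S)

  W∩L≡∅ : Disjoint W L
  W∩L≡∅ v∈W v∈L = x∈∁p⇒x∉p v∈W (q⊆p∪q S L v∈L)

  S⊆∁L : S ⊆ ∁ L
  S⊆∁L v∈S = x∉p⇒x∈∁p (S∩L≡∅ v∈S)

  ∁L∖S≡W : ∁ L ∖ S ≡ W
  ∁L∖S≡W = ⊆-antisym
    (λ v∈ → case ∖⁻ (∁ L) S v∈ of λ (v∈∁L , v∉S) → ∈-W⁺ v∉S (x∈∁p⇒x∉p v∈∁L))
    (λ v∈W → ∖⁺ (x∉p⇒x∈∁p (W∩L≡∅ v∈W)) (W∩S≡∅ v∈W))

  -- The bound γ₁₁ ≤ 2γ - 1.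

  -- Domination provides one neighbour in X, closedness excludes a second.
  closed⇒perfect : ∀ {D X} → D ⊆ X → Dominating T D → Closed X → PerfectDominating T X
  closed⇒perfect D⊆X dom closed v v∉X with dom v (v∉X ∘ D⊆X)
  ... | u , u∈D , v~u = ≤-antisym (closed v∉X) (deg≥1 v~u (D⊆X u∈D))

  γ-minimal : ∀ {D} → Dominating T D → γ T ≤ ∣ D ∣
  γ-minimal = proj₂ (proj₂ (domination T)) _

  γ₁₁-minimal : ∀ {P} → PerfectDominating T P → γ₁₁ T ≤ ∣ P ∣
  γ₁₁-minimal = proj₂ (proj₂ (perfectDomination T)) _

  dominating-nonempty : ∀ {D} → Dominating T D → Nonempty D
  dominating-nonempty {D} dom with ∣∣≥1⇒nonempty ⊤ (subst (1 ≤_) (sym (∣⊤∣≡n n)) (≤-trans (s≤s z≤n) 3≤n))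
  ... | v , _ with v ∈? D
  ... | yes v∈D = v , v∈D
  ... | no  v∉D with dom v v∉D
  ... | u , u∈D , _ = u , u∈D

  γ≥1 : 1 ≤ γ T
  γ≥1 with proj₁ (proj₂ (domination T))
  ... | D , dom , ∣D∣≡γ = subst (1 ≤_) ∣D∣≡γ (nonempty⇒∣∣≥1 (proj₂ (dominating-nonempty dom)))

  -- Dropping `E D` from the count gives 4(|X| - |D|) ≤ `E X`, and the forest bound gives `E X` ≤
  -- 2|X| - 2.
  closure-card : ∀ {D X} → D ⊆ X → Nonempty D → E D + 4 * ∣ X ∣ ≤ E X + 4 * ∣ D ∣ → ∣ X ∣ + 1 ≤ 2 * ∣ D ∣
  closure-card {D} {X} D⊆X (v , v∈D) count = *-cancelˡ-≤ 2
    (linear _ _ (+-mono-≤ count (forest-edges X (v , D⊆X v∈D)))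
      (≤-trans (m≤m+n _ (E D)) (≤-reflexive (regroup (E D) (E X) (∣ D ∣) (∣ X ∣)))))
    where
    regroup : ∀ a b c d → 2 * (d + 1) + (b + 4 * c + 2 * d) + a ≡ 2 * (2 * c) + (a + 4 * d + (b + 2))
    regroup = solve-∀

  γ₁₁<2γ : γ₁₁ T + 1 ≤ 2 * γ T
  γ₁₁<2γ with proj₁ (proj₂ (domination T))
  ... | D , dom , ∣D∣≡γ with closure D
  ... | X , D⊆X , closed , count , _ = ≤-trans
    (+-monoˡ-≤ 1 (γ₁₁-minimal (closed⇒perfect D⊆X dom closed)))
    (subst (λ k → ∣ X ∣ + 1 ≤ 2 * k) ∣D∣≡γ (closure-card D⊆X (dominating-nonempty dom) count))

  -- Components of T - (S ∪ L) and their edges.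

  ∈-neighboursOf⁺ : ∀ {X u v} → v ∈ X → v ~ u → u ∈ neighboursOf T X
  ∈-neighboursOf⁺ {X} {v = v} v∈X v~u =
    ∈-setOf⁺ (λ u → any? (λ v → (v ∈? X) ×-dec (v ~? u))) (v , v∈X , v~u)

  ∈-neighboursOf⁻ : ∀ {X u} → u ∈ neighboursOf T X → ∃[ v ] v ∈ X × v ~ u
  ∈-neighboursOf⁻ {X} = ∈-setOf⁻ (λ u → any? (λ v → (v ∈? X) ×-dec (v ~? u)))

  -- A vertex of S lies outside the connected set C and so has at most one neighbour in it; counting
  -- vertices of S next to C therefore counts edges.
  ∣N∩S∣≡edges : ∀ {C} → C ⊆ W → ConnectedSet T C → ∣ neighboursOf T C ∩ S ∣ ≡ edges C S
  ∣N∩S∣≡edges {C} C⊆W conn = trans (∣∣≡sum (neighboursOf T C ∩ S))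
    (trans (sum-cong-≗ pointwise) (edges-comm S C))
    where
    pointwise : ∀ s → χ (neighboursOf T C ∩ S) s ≡ χ S s * deg s C
    pointwise s = trans (χ-∩ (neighboursOf T C) S s) (trans (*-comm _ (χ S s)) (rest (s ∈? S)))
      where
      rest : Dec (s ∈ S) → χ S s * χ (neighboursOf T C) s ≡ χ S s * deg s C
      rest (no s∉S) rewrite χ-∉ s∉S = refl
      rest (yes s∈S) with s ∈? neighboursOf T C
      ... | yes s∈N with ∈-neighboursOf⁻ s∈N
      ... | v , v∈C , v~s = cong (χ S s *_) (trans (χ-∈ s∈N) (sym (≤-antisym
        (outside-connected conn (λ s∈C → W∩S≡∅ (C⊆W s∈C) s∈S)) (deg≥1 (~-sym v~s) v∈C))))
      rest (yes s∈S) | no s∉N = cong (χ S s *_) (trans (χ-∉ s∉N)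
        (sym (deg≡0 C (λ s~v v∈C → s∉N (∈-neighboursOf⁺ v∈C (~-sym s~v))))))

  dominated : Dominating T S → ∀ {v} → v ∈ W → 1 ≤ deg v S
  dominated dom {v} v∈W with dom v (W∩S≡∅ v∈W)
  ... | u , u∈S , v~u = deg≥1 v~u u∈S

  -- The numbers `deg v S` for v ∈ C are all at least 1 and add up to the size of N(C) ∩ S. Their
  -- sum exceeds `∣ C ∣` by one exactly when one of them is 2 and the others are 1.
  count⇔oneDoubly : Dominating T S → ∀ C → IsRemainingComponent T C →
                    ComponentCount T C ⇔ OneDoublyDominated T C
  count⇔oneDoubly dom C (C⊆W , conn , _) = mk⇔ to from
    where
    ≥1 : ∀ {v} → v ∈ C → 1 ≤ deg v S
    ≥1 v∈C = dominated dom (C⊆W v∈C)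

    to : ComponentCount T C → OneDoublyDominated T C
    to count with any? (λ v → (v ∈? C) ×-dec (2 ≤? deg v S))
    ... | no none = contradiction
      (≤-trans (≤-reflexive (sym edges≡)) (∑∈≤∣∣ C (λ v → deg v S) (λ {v} v∈C → ≤-pred (≰⇒> λ h → none (v , v∈C , h)))))
      (λ h → m+1+n≰m ∣ C ∣ h)
      where
      edges≡ : edges C S ≡ ∣ C ∣ + 1
      edges≡ = trans (sym (∣N∩S∣≡edges C⊆W conn)) count
    ... | yes (v , v∈C , 2≤) = v , v∈C , ≤-antisym ≤2 2≤ , λ u u∈C u≢v →
          let u∈R = ∖⁺ u∈C (x≢y⇒x∉⁅y⁆ u≢v) in
          ≤-antisym (∑∈≤∣∣⇒≤1 R (λ v → deg v S) (≥1 ∘ R⊆C) rest≤ u∈R) (≥1 u∈C)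
      where
      R = C ∖ ⁅ v ⁆
      R⊆C : R ⊆ C
      R⊆C = proj₁ ∘ ∖⁻ C ⁅ v ⁆
      total : deg v S + edges R S ≡ 2 + ∣ R ∣
      total = trans (sym (∑∈-⁅⁆-split C (λ v → deg v S) v∈C))
        (trans (trans (sym (∣N∩S∣≡edges C⊆W conn)) count)
        (trans (+-comm ∣ C ∣ 1) (cong suc (∣∖⁅⁆∣ v∈C))))
      ≤2 : deg v S ≤ 2
      ≤2 = linear _ _ (∑∈≥∣∣ R (λ v → deg v S) (≥1 ∘ R⊆C)) (≤-reflexive total)
      rest≤ : edges R S ≤ ∣ R ∣
      rest≤ = linear _ _ 2≤ (≤-reflexive (trans (+-comm (edges R S) _) (trans total (+-comm 2 ∣ R ∣))))

    from : OneDoublyDominated T C → ComponentCount T C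
    from (v , v∈C , ≡2 , ≡1) = begin
      ∣ neighboursOf T C ∩ S ∣  ≡⟨ ∣N∩S∣≡edges C⊆W conn ⟩
      edges C S                 ≡⟨ ∑∈-⁅⁆-split C (λ v → deg v S) v∈C ⟩
      deg v S + edges R S       ≡⟨ cong₂ _+_ ≡2 (trans (∑∈-cong R ≡1′) (sym (∣∣≡∑∈ R))) ⟩
      2 + ∣ R ∣                 ≡⟨ cong suc (sym (∣∖⁅⁆∣ v∈C)) ⟩
      suc ∣ C ∣                 ≡⟨ +-comm 1 ∣ C ∣ ⟩
      ∣ C ∣ + 1                 ∎
      where
      open ≡-Reasoning
      R = C ∖ ⁅ v ⁆
      ≡1′ : ∀ {u} → u ∈ R → deg u S ≡ 1
      ≡1′ {u} u∈R with ∖⁻ C ⁅ v ⁆ u∈R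
      ... | u∈C , u∉v = ≡1 u u∈C (x∉⁅y⁆⇒x≢y u∉v)

  closed⇒component : ∀ {C} → C ⊆ W → ConnectedSet T C → ClosedWithin W C → IsRemainingComponent T C
  closed⇒component C⊆W conn closed = C⊆W , conn , λ D D⊆W (_ , walkD) C⊆D {v} v∈D →
    let (u , u∈C) = proj₁ conn in
    walk-stays closed (Star.map (λ (a , b , c) → D⊆W a , D⊆W b , c) (walkD u v (C⊆D u∈C) v∈D)) u∈C

  -- The component A of W grown from a vertex c of C contains C, so maximality gives A ⊆ C, and A is
  -- closed within W.
  component⇒closed : ∀ {C} → IsRemainingComponent T C → ClosedWithin W C
  component⇒closed {C} (C⊆W , ((c , c∈C) , walkC) , maximal) {u} {v} u∈C v∈W u~v
    with component W c (C⊆W c∈C)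
  ... | A , A⊆W , c∈A , conn , closed , _ = maximal A A⊆W conn C⊆A (closed (C⊆A u∈C) v∈W u~v)
    where
    C⊆A : C ⊆ A
    C⊆A {w} w∈C = walk-stays closed
      (Star.map (λ (a , b , c) → C⊆W a , C⊆W b , c) (walkC c w c∈C w∈C)) c∈A

  -- Twice the number of edges with an end in Z, for Z a union of components of T − (S ∪ L).
  weight : Subset n → ℕ
  weight Z = E Z + 2 * edges Z S

  -- No edge joins C to the rest of Z, so each edge with an end in Z is counted in exactly one of
  -- the two parts.
  weight-split : ∀ {C Z} → C ⊆ Z → ClosedWithin Z C → weight Z ≡ weight C + weight (Z ∖ C)
  weight-split {C} {Z} C⊆Z closed = begin
    E Z + 2 * edges Z S
      ≡⟨ cong₂ (λ a b → a + 2 * b) (E-split C⊆Z) (∑∈-split _ C⊆Z) ⟩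
    E C + 2 * edges (Z ∖ C) C + E (Z ∖ C) + 2 * (edges C S + edges (Z ∖ C) S)
      ≡⟨ cong (λ t → E C + 2 * t + E (Z ∖ C) + 2 * (edges C S + edges (Z ∖ C) S)) none ⟩
    E C + 0 + E (Z ∖ C) + 2 * (edges C S + edges (Z ∖ C) S)
      ≡⟨ regroup (E C) (E (Z ∖ C)) (edges C S) (edges (Z ∖ C) S) ⟩
    weight C + weight (Z ∖ C) ∎
    where
    open ≡-Reasoning
    none : edges (Z ∖ C) C ≡ 0
    none = edges≡0 (Z ∖ C) C λ u∈ v∈C u~v → case ∖⁻ Z C u∈ of λ
      (u∈Z , u∉C) → u∉C (closed v∈C u∈Z (~-sym u~v))
    regroup : ∀ a b c d → a + 0 + b + 2 * (c + d) ≡ a + 2 * c + (b + 2 * d)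
    regroup = solve-∀

  ∖-closed : ∀ {C Z} → ClosedWithin W Z → ClosedWithin Z C → ClosedWithin W (Z ∖ C)
  ∖-closed {C} {Z} closedZ closedC u∈ v∈W u~v with ∖⁻ Z C u∈
  ... | u∈Z , u∉C = ∖⁺ (closedZ u∈Z v∈W u~v) (λ v∈C → u∉C (closedC v∈C u∈Z (~-sym u~v)))

  -- The conditions imply equality.

  -- The tree has at least n - 1 edges. Each leaf has at most one neighbour and none among the
  -- leaves, so deleting all leaves loses no more edges than vertices.
  nonleaf-edges : 2 * ∣ ∁ L ∣ ≤ E (∁ L) + 2
  nonleaf-edges = arithmetic (connected⇒edges (proj₁ tree)) E⊤≡ ∣⊤∣≡ leaf-edges
    where
    ⊤∖∁L≡L : ⊤ ∖ ∁ L ≡ L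
    ⊤∖∁L≡L = ⊆-antisym (λ v∈ → x∉∁p⇒x∈p (proj₂ (∖⁻ ⊤ (∁ L) v∈))) (λ v∈L → ∖⁺ ∈⊤ (x∈p⇒x∉∁p v∈L))
    leaf-edges : edges L (∁ L) ≤ ∣ L ∣
    leaf-edges = ∑∈≤∣∣ L (λ v → deg v (∁ L)) (λ v∈L → deg-leaf v∈L (∁ L))
    E⊤≡ : E ⊤ ≡ E (∁ L) + 2 * edges L (∁ L)
    E⊤≡ = trans (E-split {⊤} {∁ L} ⊆⊤) (trans
      (cong₂ (λ X k → E (∁ L) + 2 * edges X (∁ L) + k) ⊤∖∁L≡L
        (trans (cong E ⊤∖∁L≡L) (edges≡0 L L leaves-not-adjacent)))
      (+-identityʳ _))
    ∣⊤∣≡ : ∣ ⊤ {n} ∣ ≡ ∣ ∁ L ∣ + ∣ L ∣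
    ∣⊤∣≡ = trans (∣∣-split {X = ⊤} {∁ L} ⊆⊤) (cong (λ X → ∣ ∁ L ∣ + ∣ X ∣) ⊤∖∁L≡L)
    arithmetic : ∀ {t x l e⊤ e d} → 2 * t ≤ e⊤ + 2 → e⊤ ≡ e + 2 * d → t ≡ x + l → d ≤ l →
                 2 * x ≤ e + 2
    arithmetic {x = x} {l} {e = e} {d} h refl refl d≤l =
      linear _ _ (+-mono-≤ h (*-monoʳ-≤ 2 d≤l)) (≤-reflexive (regroup x e d l))
      where
      regroup : ∀ a b c d → 2 * a + (b + 2 * c + 2 + 2 * d) ≡ b + 2 + (2 * (a + d) + 2 * c)
      regroup = solve-∀

  -- Components are split off one at a time. Each has at most |C| - 1 inner edges and, by the count,
  -- |C| + 1 edges to S, hence weight at most 4|C|.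
  closedUnion-weight : (∀ C → IsRemainingComponent T C → ComponentCount T C) →
                       ∀ Z → Z ⊆ W → ClosedWithin W Z → weight Z ≤ 4 * ∣ Z ∣
  closedUnion-weight counts Z = go Z (<-wellFounded _)
    where
    go : ∀ Z → Acc _<_ ∣ Z ∣ → Z ⊆ W → ClosedWithin W Z → weight Z ≤ 4 * ∣ Z ∣
    go Z (acc rec) Z⊆W closedZ with nonempty? Z
    ... | no empty = ≤-trans (≤-reflexive (cong₂ (λ a b → a + 2 * b) (none Z) (none S))) z≤n
      where
      none : ∀ Y → edges Z Y ≡ 0
      none Y = edges≡0 Z Y (λ u∈Z → contradiction (_ , u∈Z) empty)
    ... | yes (v , v∈Z) with component Z v v∈Z
    ... | C , C⊆Z , v∈C , conn , closedC , _ =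
      arithmetic (weight-split C⊆Z closedC) (∣∣-split C⊆Z) (forest-edges C (v , v∈C))
        (trans (sym (∣N∩S∣≡edges C⊆W conn)) (counts C (closed⇒component C⊆W conn closedWC)))
        (go (Z ∖ C) (rec smaller) (Z⊆W ∘ proj₁ ∘ ∖⁻ Z C) (∖-closed closedZ closedC))
      where
      C⊆W : C ⊆ W
      C⊆W = Z⊆W ∘ C⊆Z

      closedWC : ClosedWithin W C
      closedWC u∈C v∈W u~v = closedC u∈C (closedZ (C⊆Z u∈C) v∈W u~v) u~v

      smaller : ∣ Z ∖ C ∣ < ∣ Z ∣
      smaller = subst (suc ∣ Z ∖ C ∣ ≤_) (sym (∣∣-split C⊆Z))
        (+-monoˡ-≤ ∣ Z ∖ C ∣ (nonempty⇒∣∣≥1 v∈C))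

      arithmetic : ∀ {z c r wz e s wr} → wz ≡ (e + 2 * s) + wr → z ≡ c + r → e + 2 ≤ 2 * c →
                   s ≡ c + 1 → wr ≤ 4 * r → wz ≤ 4 * z
      arithmetic {c = c} {r} {e = e} {wr = wr} refl refl h refl h′ =
        linear _ _ (+-mono-≤ h h′) (≤-reflexive (regroup c r e wr))
        where
        regroup : ∀ c r e w → e + 2 * (c + 1) + w + (2 * c + 4 * r) ≡ 4 * (c + r) + (e + 2 + w)
        regroup = solve-∀

  -- If s were outside P, each leaf at s would have to be in P, its only neighbour being s. Then s
  -- would have two neighbours in P.
  strongSupports-forced : ∀ {P} → PerfectDominating T P → S ⊆ P
  strongSupports-forced {P} perfect {s} s∈S with s ∈? P
  ... | yes s∈P = s∈P
  ... | no  s∉P = contradiction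
      (≤-trans (∈-S⁻ s∈S) (≤-trans (p⊆q⇒∣p∣≤∣q∣ leaves⊆P) (≤-reflexive (perfect s s∉P)))) λ { (s≤s ()) }
    where
    leaves⊆P : N s ∩ L ⊆ N s ∩ P
    leaves⊆P {v} v∈ with x∈p∩q⁻ (N s) L v∈ | v ∈? P
    ... | v∈N , v∈L | yes v∈P = x∈p∩q⁺ (v∈N , v∈P)
    ... | v∈N , v∈L | no  v∉P with deg≥1⇒neighbour P (≤-reflexive (sym (perfect v v∉P)))
    ... | u , v~u , u∈P =
      contradiction (subst (_∈ P) (leaf-unique v∈L v~u (~-sym (∈-N⁻ v∈N))) u∈P) s∉P

  forced : ∀ {P v u w} → PerfectDominating T P → v ~ u → u ∈ P → v ~ w → w ∈ P → u ≢ w → v ∈ P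
  forced {P} {v} perfect v~u u∈P v~w w∈P u≢w with v ∈? P
  ... | yes v∈P = v∈P
  ... | no  v∉P = contradiction
    (≤-trans (deg≥2 v~u u∈P v~w w∈P u≢w) (≤-reflexive (perfect v v∉P))) λ { (s≤s ()) }

  component-forced : ∀ {P C} → Dominating T S → PerfectDominating T P → IsRemainingComponent T C →
                     OneDoublyDominated T C → C ⊆ P
  component-forced {P} {C} dom perfect (C⊆W , (_ , walkC) , _) (v , v∈C , ≡2 , _) {w} w∈C =
    spread (walkC v w v∈C w∈C) v∈P
    where
    S⊆P : S ⊆ P
    S⊆P = strongSupports-forced perfect

    v∈P : v ∈ P
    v∈P with deg≥1⇒neighbour S (subst (1 ≤_) (sym ≡2) (s≤s z≤n))
    ... | a , v~a , a∈S with deg≥2⇒other S (≤-reflexive (sym ≡2)) a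
    ... | b , v~b , b∈S , b≢a = forced perfect v~b (S⊆P b∈S) v~a (S⊆P a∈S) b≢a

    -- The next vertex y on the walk has two neighbours in P: its predecessor x and a vertex of S,
    -- which differ because x lies in W.
    spread : ∀ {x y} → Star (AdjacentWithin T C) x y → x ∈ P → y ∈ P
    spread ε x∈P = x∈P
    spread ((x∈C , y∈C , x~y) ◅ walk) x∈P with dom _ (W∩S≡∅ (C⊆W y∈C))
    ... | s , s∈S , y~s = spread walk (forced perfect (~-sym x~y) x∈P y~s (S⊆P s∈S)
      (λ x≡s → W∩S≡∅ (C⊆W x∈C) (subst (_∈ S) (sym x≡s) s∈S)))

  nonleaf-weight : E S ≡ 0 → E (∁ L) ≡ weight W
  nonleaf-weight E-S≡0 = trans (E-split S⊆∁L) (trans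
    (cong₂ (λ k X → k + 2 * edges X S + E X) E-S≡0 ∁L∖S≡W)
    (+-comm (2 * edges W S) (E W)))

  ∣∁L∣≡ : ∣ ∁ L ∣ ≡ ∣ S ∣ + ∣ W ∣
  ∣∁L∣≡ = trans (∣∣-split S⊆∁L) (cong (λ X → ∣ S ∣ + ∣ X ∣) ∁L∖S≡W)

  conditions⇒2γ≤γ₁₁+1 : IndependentDominating T S →
    (∀ C → IsRemainingComponent T C → ComponentCount T C) → 2 * γ T ≤ γ₁₁ T + 1
  conditions⇒2γ≤γ₁₁+1 (indep , dom) counts =
    -- With x, s, w the sizes of `∁ L`, S and W: 2x - 2 ≤ `E (∁ L)` ≤ 4w and x = s + w give 2s - 1 ≤
    -- x, where γ ≤ s and x ≤ γ₁₁.
    arithmetic (γ-minimal dom) (≤-trans (p⊆q⇒∣p∣≤∣q∣ nonleaves⊆P) (≤-reflexive ∣P∣≡))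
      ∣∁L∣≡ nonleaf-edges (nonleaf-weight (edges≡0 S S (λ u∈S v∈S → indep _ _ u∈S v∈S)))
      (closedUnion-weight counts W (λ v∈W → v∈W) (λ _ v∈W _ → v∈W))
    where
    P : Subset n
    P = proj₁ (proj₁ (proj₂ (perfectDomination T)))

    perfect : PerfectDominating T P
    perfect = proj₁ (proj₂ (proj₁ (proj₂ (perfectDomination T))))

    ∣P∣≡ : ∣ P ∣ ≡ γ₁₁ T
    ∣P∣≡ = proj₂ (proj₂ (proj₁ (proj₂ (perfectDomination T))))

    nonleaves⊆P : ∁ L ⊆ P
    nonleaves⊆P {v} v∈∁L with v ∈? S
    ... | yes v∈S = strongSupports-forced perfect v∈S
    ... | no  v∉S with component W v (∈-W⁺ v∉S (x∈∁p⇒x∉p v∈∁L))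
    ... | C , C⊆W , v∈C , conn , closed , _ =
      let isC = closed⇒component C⊆W conn closed in
      component-forced dom perfect isC (Equivalence.to (count⇔oneDoubly dom C isC) (counts C isC)) v∈C

    arithmetic : ∀ {g h x s w e f} → g ≤ s → x ≤ h → x ≡ s + w → 2 * x ≤ e + 2 → e ≡ f → f ≤ 4 * w →
                 2 * g ≤ h + 1
    arithmetic {g} {h} {x} {s} {w} {e} g≤s x≤h refl hx refl he = *-cancelˡ-≤ 2
      (linear _ _ (+-mono-≤ (*-monoʳ-≤ 4 g≤s) (+-mono-≤ (*-monoʳ-≤ 2 x≤h) (+-mono-≤ hx (+-mono-≤ he ≤-refl))))
        (≤-reflexive (regroup g h s w e)))
      where
      regroup : ∀ g h s w e → 2 * (2 * g) + (4 * s + (2 * h + (e + 2 + (4 * w + 0)))) ≡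
                2 * (h + 1) + (4 * g + (2 * (s + w) + (2 * (s + w) + (e + 0))))
      regroup = solve-∀

  -- A minimum dominating set without leaves.

  replaceLeaf : Fin n → Fin n
  replaceLeaf v with v ∈? L
  ... | yes _ = proj₁ (has-neighbour v)
  ... | no  _ = v

  replaceLeaf-∉L : ∀ v → replaceLeaf v ∉ L
  replaceLeaf-∉L v with v ∈? L
  ... | yes v∈L = λ u∈L → leaves-not-adjacent v∈L u∈L (proj₂ (has-neighbour v))
  ... | no  v∉L = v∉L

  replaceLeaf-leaf : ∀ {v} → v ∈ L → v ~ replaceLeaf v
  replaceLeaf-leaf {v} v∈L with v ∈? L
  ... | yes _   = proj₂ (has-neighbour v)
  ... | no  v∉L = contradiction v∈L v∉L

  replaceLeaf-nonleaf : ∀ {v} → v ∉ L → replaceLeaf v ≡ v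
  replaceLeaf-nonleaf {v} v∉L with v ∈? L
  ... | yes v∈L = contradiction v∈L v∉L
  ... | no  _   = refl

  -- A leaf dominates only itself and its neighbour, and this neighbour dominates both as well.
  replaceLeaf-dominating : ∀ {D} → Dominating T D → Dominating T (image replaceLeaf D)
  replaceLeaf-dominating {D} dom v v∉ with v ∈? D
  ... | yes v∈D with v ∈? L
  ...   | yes v∈L = replaceLeaf v , ∈-image⁺ replaceLeaf v∈D , replaceLeaf-leaf v∈L
  ...   | no  v∉L = contradiction
          (subst (_∈ image replaceLeaf D) (replaceLeaf-nonleaf v∉L) (∈-image⁺ replaceLeaf v∈D)) v∉
  replaceLeaf-dominating {D} dom v v∉ | no v∉D with dom v v∉D
  ... | u , u∈D , v~u with u ∈? L
  ...   | yes u∈L = contradiction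
          (subst (_∈ image replaceLeaf D) (leaf-unique u∈L (replaceLeaf-leaf u∈L) (~-sym v~u))
            (∈-image⁺ replaceLeaf u∈D)) v∉
  ...   | no  u∉L = u ,
          subst (_∈ image replaceLeaf D) (replaceLeaf-nonleaf u∉L) (∈-image⁺ replaceLeaf u∈D) , v~u

  minimum-leafless : ∃[ D ] Dominating T D × Disjoint D L × ∣ D ∣ ≡ γ T
  minimum-leafless with proj₁ (proj₂ (domination T))
  ... | D , dom , ∣D∣≡γ = D′ , dom′ , leafless ,
        ≤-antisym (≤-trans (∣image∣≤ replaceLeaf D) (≤-reflexive ∣D∣≡γ)) (γ-minimal dom′)
    where
    D′ : Subset n
    D′ = image replaceLeaf D

    dom′ : Dominating T D′
    dom′ = replaceLeaf-dominating dom

    leafless : Disjoint D′ L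
    leafless u∈D′ u∈L with ∈-image⁻ replaceLeaf u∈D′
    ... | v , _ , eq = replaceLeaf-∉L v (subst (_∈ L) (sym eq) u∈L)

  leafless-supports : ∀ {D v s} → Dominating T D → Disjoint D L → v ∈ L → v ~ s → s ∈ D
  leafless-supports dom leafless v∈L v~s with dom _ (λ v∈D → leafless v∈D v∈L)
  ... | u , u∈D , v~u = subst (_∈ _) (leaf-unique v∈L v~u v~s) u∈D

  -- Equality implies the conditions: the closure X of D.

  module Extremal (extremal : γ₁₁ T + 1 ≡ 2 * γ T) {D : Subset n} (dom : Dominating T D)
    (leafless : Disjoint D L) (∣D∣≡γ : ∣ D ∣ ≡ γ T) {X : Subset n} (D⊆X : D ⊆ X) (closed : Closed X)
    (count : E D + 4 * ∣ X ∣ ≤ E X + 4 * ∣ D ∣) (least : ∀ {Z} → D ⊆ Z → Closed Z → X ⊆ Z) where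

    perfect : PerfectDominating T X
    perfect = closed⇒perfect D⊆X dom closed

    -- The upper bound is `closure-card`; the lower one holds because X is perfect dominating and so
    -- has at least γ₁₁ = 2γ - 1 vertices.
    ∣X∣+1≡2∣D∣ : ∣ X ∣ + 1 ≡ 2 * ∣ D ∣
    ∣X∣+1≡2∣D∣ = ≤-antisym (closure-card D⊆X (dominating-nonempty dom) count)
      (≤-trans (≤-reflexive (trans (cong (2 *_) ∣D∣≡γ) (sym extremal))) (+-monoˡ-≤ 1 (γ₁₁-minimal perfect)))

    γ₁₁≡∣X∣ : γ₁₁ T ≡ ∣ X ∣
    γ₁₁≡∣X∣ = +-cancelʳ-≡ 1 _ _ (trans extremal (sym (trans ∣X∣+1≡2∣D∣ (cong (2 *_) ∣D∣≡γ))))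

    forest-X : E X + 2 ≤ 2 * ∣ X ∣
    forest-X with dominating-nonempty dom
    ... | v , v∈D = forest-edges X (v , D⊆X v∈D)

    -- `E D` is the slack dropped in `closure-card`; equality there leaves none, so D is
    -- independent.
    E-D≡0 : E D ≡ 0
    E-D≡0 = arithmetic {E D} {∣ X ∣} {E X} {∣ D ∣} count forest-X ∣X∣+1≡2∣D∣
      where
      arithmetic : ∀ {e x f d} → e + 4 * x ≤ f + 4 * d → f + 2 ≤ 2 * x → x + 1 ≡ 2 * d → e ≡ 0
      arithmetic {e} {x} {f} {d} h h′ eq = n≤0⇒n≡0
        (linear _ _ (+-mono-≤ h (+-mono-≤ h′ (*-monoʳ-≤ 2 (≤-reflexive (sym eq)))))
          (≤-reflexive (regroup e x f d)))
        where
        regroup : ∀ e x f d → e + (f + 4 * d + (2 * x + 2 * (x + 1))) ≡ 0 + (e + 4 * x + (f + 2 + 2 * (2 * d)))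
        regroup = solve-∀

    -- Together with `forest-X` this says that X induces a tree.
    E-X : 2 * ∣ X ∣ ≤ E X + 2
    E-X = arithmetic {E D} {∣ X ∣} {E X} {∣ D ∣} count ∣X∣+1≡2∣D∣
      where
      arithmetic : ∀ {e x f d} → e + 4 * x ≤ f + 4 * d → x + 1 ≡ 2 * d → 2 * x ≤ f + 2
      arithmetic {e} {x} {f} {d} h eq =
        linear _ _ (+-mono-≤ h (*-monoʳ-≤ 2 (≤-reflexive (sym eq))))
          (≤-trans (m≤m+n _ e) (≤-reflexive (regroup e x f d)))
        where
        regroup : ∀ e x f d → 2 * x + (f + 4 * d + 2 * (x + 1)) + e ≡ f + 2 + (e + 4 * x + 2 * (2 * d))
        regroup = solve-∀

    -- The non-leaves include D and form a closed set, since a leaf has only one neighbour.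
    X⊆∁L : X ⊆ ∁ L
    X⊆∁L = least (x∉p⇒x∈∁p ∘ leafless) (λ v∉∁L → deg-leaf (x∉∁p⇒x∈p v∉∁L) (∁ L))

    support∈D : ∀ {v s} → v ∈ L → v ~ s → s ∈ D
    support∈D = leafless-supports dom leafless

    -- Two adjacent vertices outside X would close a cycle through the tree on X.
    outside-not-adjacent : ∀ {v w} → v ∉ X → w ∉ X → ¬ (v ~ w)
    outside-not-adjacent {v} {w} v∉X w∉X v~w with dom w (w∉X ∘ D⊆X)
    ... | u , u∈D , w~u = arithmetic {∣ X ∣} {E X} {E A} {E B} {deg v X} {deg w A} {∣ B ∣} E-X (≤-reflexive (sym (perfect v v∉X)))
        (deg≥2 {u} {v} {w} {A} w~u (p⊆p∪q ⁅ v ⁆ (D⊆X u∈D)) (~-sym v~w) (q⊆p∪q X ⁅ v ⁆ (x∈⁅x⁆ v))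
          (λ u≡v → v∉X (subst (_∈ X) u≡v (D⊆X u∈D))))
        (forest-edges B (w , q⊆p∪q A ⁅ w ⁆ (x∈⁅x⁆ w))) (E-insert {A} {w} w∉A) (E-insert {X} {v} v∉X)
        (trans (∣∪⁅⁆∣ {X = A} {w} w∉A) (cong suc (∣∪⁅⁆∣ {X = X} {v} v∉X)))
      where
      A B : Subset n
      A = X ∪ ⁅ v ⁆
      B = A ∪ ⁅ w ⁆

      w∉A : w ∉ A
      w∉A w∈A with x∈p∪q⁻ X ⁅ v ⁆ w∈A
      ... | inj₁ w∈X = w∉X w∈X
      ... | inj₂ w∈v = ~-irrefl (sym (x∈⁅y⁆⇒x≡y v w∈v)) v~w

      arithmetic : ∀ {x e eA eB dv dw b} → 2 * x ≤ e + 2 → 1 ≤ dv → 2 ≤ dw → eB + 2 ≤ 2 * b →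
                   eB ≡ eA + 2 * dw → eA ≡ e + 2 * dv → b ≡ suc (suc x) → ⊥
      arithmetic {x} {e} {dv = dv} {dw} hx hv hw hB refl refl refl = contradiction
        (linear 2 0 (+-mono-≤ hx (+-mono-≤ (*-monoʳ-≤ 2 hv) (+-mono-≤ (*-monoʳ-≤ 2 hw) hB)))
          (≤-reflexive (regroup x e dv dw))) λ ()
        where
        regroup : ∀ x e v w → 2 + (e + 2 + (2 * v + (2 * w + 2 * suc (suc x)))) ≡
                  2 * x + (2 + (4 + (e + 2 * v + 2 * w + 2)))
        regroup = solve-∀

    -- A non-leaf outside X has at least two neighbours but only one in X, so another one would be
    -- outside X too.
    ∁L⊆X : ∁ L ⊆ X
    ∁L⊆X {v} v∈∁L with v ∈? X
    ... | yes v∈X = v∈X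
    ... | no  v∉X with dom v (v∉X ∘ D⊆X)
    ... | u , u∈D , v~u with nonleaf-other (x∈∁p⇒x∉p v∈∁L) u
    ... | w , v~w , w≢u = contradiction v~w (outside-not-adjacent v∉X λ w∈X →
          w≢u (deg≤1⇒unique (closed v∉X) v~w w∈X v~u (D⊆X u∈D)))

    X≡∁L : X ≡ ∁ L
    X≡∁L = ⊆-antisym X⊆∁L ∁L⊆X

    -- Each Y between D and X satisfies closure Y = X.
    reclosure : ∀ {Y} → D ⊆ Y → Y ⊆ X → E Y + 4 * ∣ X ∣ ≤ E X + 4 * ∣ Y ∣
    reclosure {Y} D⊆Y Y⊆X with closure Y
    ... | Z , Y⊆Z , closedZ , countZ , leastZ =
      subst (λ A → E Y + 4 * ∣ A ∣ ≤ E A + 4 * ∣ Y ∣)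
        (⊆-antisym (leastZ Y⊆X closed) (least (Y⊆Z ∘ D⊆Y) closedZ)) countZ

    -- A vertex d of D that is not a strong support vertex leads to a contradiction.

    module Removal {d : Fin n} (d∈D : d ∈ D) (d-weak : deg d L ≤ 1) {X′ : Subset n}
      (D′⊆X′ : D ∖ ⁅ d ⁆ ⊆ X′) (closed′ : Closed X′)
      (count′ : E (D ∖ ⁅ d ⁆) + 4 * ∣ X′ ∣ ≤ E X′ + 4 * ∣ D ∖ ⁅ d ⁆ ∣)
      (least′ : ∀ {Z} → D ∖ ⁅ d ⁆ ⊆ Z → Closed Z → X′ ⊆ Z) where

      R R′ : Subset n
      R  = X ∖ X′
      R′ = R ∖ ⁅ d ⁆

      X′⊆X : X′ ⊆ X
      X′⊆X = least′ (D⊆X ∘ proj₁ ∘ ∖⁻ D ⁅ d ⁆) closed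

      D⊆X′∪d : D ⊆ X′ ∪ ⁅ d ⁆
      D⊆X′∪d {v} v∈D with v ∈? ⁅ d ⁆
      ... | yes v∈d = q⊆p∪q X′ _ v∈d
      ... | no  v∉d = p⊆p∪q ⁅ d ⁆ (D′⊆X′ (∖⁺ v∈D v∉d))

      -- Otherwise X′ would contain D and be all of X, which is too large for the closure of only
      -- `∣ D ∣` - 1 vertices.
      d∉X′ : d ∉ X′
      d∉X′ d∈X′ = arithmetic {E (D ∖ ⁅ d ⁆)} {∣ X ∣} {E X} {∣ D ∣} {∣ D ∖ ⁅ d ⁆ ∣}
          (subst (λ A → E (D ∖ ⁅ d ⁆) + 4 * ∣ A ∣ ≤ E A + 4 * ∣ D ∖ ⁅ d ⁆ ∣) X′≡X count′)
          forest-X ∣X∣+1≡2∣D∣ (∣∖⁅⁆∣ d∈D)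
        where
        D⊆X′ : D ⊆ X′
        D⊆X′ v∈D with x∈p∪q⁻ X′ ⁅ d ⁆ (D⊆X′∪d v∈D)
        ... | inj₁ v∈X′ = v∈X′
        ... | inj₂ v∈d  = ⁅⁆⊆ d∈X′ v∈d

        X′≡X : X′ ≡ X
        X′≡X = ⊆-antisym X′⊆X (least D⊆X′ closed′)

        arithmetic : ∀ {e x f d d′} → e + 4 * x ≤ f + 4 * d′ → f + 2 ≤ 2 * x → x + 1 ≡ 2 * d → d ≡ suc d′ → ⊥
        arithmetic {e} {x} {f} {d′ = d′} h h′ eq refl = contradiction
          (linear 4 0 (+-mono-≤ h (+-mono-≤ h′ (*-monoʳ-≤ 2 (≤-reflexive (sym eq)))))
            (≤-trans (m≤m+n _ e) (≤-reflexive (regroup e x f d′)))) λ ()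
          where
          regroup : ∀ e x f d → 4 + (f + 4 * d + (2 * x + 2 * (x + 1))) + e ≡
                    e + 4 * x + (f + 2 + 2 * (2 * suc d))
          regroup = solve-∀

      recount : E X′ + 2 * deg d X′ + 4 * ∣ X ∣ ≤ E X + 4 * suc ∣ X′ ∣
      recount = subst₂ (λ a b → a + 4 * ∣ X ∣ ≤ E X + 4 * b) (E-insert d∉X′) (∣∪⁅⁆∣ d∉X′)
        (reclosure D⊆X′∪d λ v∈ → case x∈p∪q⁻ X′ ⁅ d ⁆ v∈ of λ
          { (inj₁ v∈X′) → X′⊆X v∈X′ ; (inj₂ v∈d) → ⁅⁆⊆ (D⊆X d∈D) v∈d })

      -- Closing D without d, adding d and closing again yields X. The edges gained in the two
      -- closures already exhaust the forest bound for X, so none is left between d and X′.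
      deg-d≡0 : deg d X′ ≡ 0
      deg-d≡0 = arithmetic {E (D ∖ ⁅ d ⁆)} {∣ X′ ∣} {E X′} {∣ D ∖ ⁅ d ⁆ ∣} {deg d X′} {∣ X ∣} {E X} {∣ D ∣} count′ recount forest-X ∣X∣+1≡2∣D∣ (∣∖⁅⁆∣ d∈D)
        where
        arithmetic : ∀ {e x′ f′ d′ k x f d} → e + 4 * x′ ≤ f′ + 4 * d′ → f′ + 2 * k + 4 * x ≤ f + 4 * suc x′ →
                     f + 2 ≤ 2 * x → x + 1 ≡ 2 * d → d ≡ suc d′ → k ≡ 0
        arithmetic {e} {x′} {f′} {d′} {k} {x} {f} h h′ h″ eq refl = n≤0⇒n≡0 (*-cancelˡ-≤ 2
          (linear (2 * k) 0 (+-mono-≤ h (+-mono-≤ h′ (+-mono-≤ h″ (*-monoʳ-≤ 2 (≤-reflexive (sym eq))))))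
            (≤-trans (m≤m+n _ e) (≤-reflexive (regroup e x′ f′ d′ k x f)))))
          where
          regroup : ∀ e x′ f′ d′ k x f →
            2 * k + (f′ + 4 * d′ + (f + 4 * suc x′ + (2 * x + 2 * (x + 1)))) + e ≡
            e + 4 * x′ + (f′ + 2 * k + 4 * x + (f + 2 + 2 * (2 * suc d′)))
          regroup = solve-∀

      d∈R : d ∈ R
      d∈R = ∖⁺ (D⊆X d∈D) d∉X′

      -- Closedness of X′ allows at most one neighbour each. Since R induces a forest, `recount`
      -- demands at least `∣ R′ ∣` edges from R′ to X′, so nobody can miss one.
      R′-dominated : ∀ {v} → v ∈ R′ → deg v X′ ≡ 1
      R′-dominated v∈R′ = ≤-antisym (≤1 v∈R′) (∑∈≥∣∣⇒≥1 R′ (λ v → deg v X′) ≤1 total v∈R′)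
        where
        ≤1 : ∀ {v} → v ∈ R′ → deg v X′ ≤ 1
        ≤1 v∈R′ = closed′ (proj₂ (∖⁻ X X′ (proj₁ (∖⁻ R ⁅ d ⁆ v∈R′))))

        arithmetic : ∀ {f′ k x f x′ r r′ s s′ g} → f′ + 2 * k + 4 * x ≤ f + 4 * suc x′ → k ≡ 0 → x ≡ x′ + r →
                     f ≡ f′ + 2 * s + g → g + 2 ≤ 2 * r → s ≡ k + s′ → r ≡ suc r′ → r′ ≤ s′
        arithmetic {f′} {x′ = x′} {r′ = r′} {s′ = s′} {g} h refl refl refl h′ refl refl =
          *-cancelˡ-≤ 2 (linear (2 * r′) (2 * s′) (+-mono-≤ h h′) (≤-reflexive (regroup f′ x′ r′ s′ g)))
          where
          regroup : ∀ f x r s g → 2 * r + (f + 2 * s + g + 4 * suc x + 2 * suc r) ≡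
                    2 * s + (f + 0 + 4 * (x + suc r) + (g + 2))
          regroup = solve-∀

        total : ∣ R′ ∣ ≤ edges R′ X′
        total = arithmetic {E X′} {deg d X′} {∣ X ∣} {E X} {∣ X′ ∣} {∣ R ∣} {∣ R′ ∣} {edges R X′} {edges R′ X′} {E R}
          recount deg-d≡0 (∣∣-split X′⊆X) (E-split X′⊆X) (forest-edges R (d , d∈R))
          (∑∈-⁅⁆-split R (λ v → deg v X′) d∈R) (∣∖⁅⁆∣ d∈R)

      -- C is a branch at d. Outside the union, d sees one vertex of C and none of X′; any other
      -- non-leaf sees one vertex of X′ and none of C; a leaf sees its support vertex, which lies in
      -- D and is not d.
      smaller-perfect : ∀ {C p} → ConnectedSet T C → Disjoint C X′ → d ∉ C → p ∈ C → d ~ p →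
        (∀ {u v} → u ∈ C → v ∈ R′ → u ~ v → v ∈ C) → (∀ {v} → v ∈ L → v ~ d → v ∈ C) →
        PerfectDominating T (X′ ∪ C)
      smaller-perfect {C} {p} conn disjoint d∉C p∈C d~p closedC leavesC v v∉P = trans
        (deg-∪ v (λ u∈X′ u∈C → disjoint u∈C u∈X′)) (go (v ≟ᶠ d) (v ∈? L))
        where
        v∉X′ : v ∉ X′
        v∉X′ = v∉P ∘ p⊆p∪q C

        v∉C : v ∉ C
        v∉C = v∉P ∘ q⊆p∪q X′ C

        go : Dec (v ≡ d) → Dec (v ∈ L) → deg v X′ + deg v C ≡ 1
        go (yes refl) _ = cong₂ _+_ deg-d≡0 (≤-antisym (outside-connected conn d∉C) (deg≥1 d~p p∈C))
        go (no v≢d) (no v∉L) = cong₂ _+_ (R′-dominated v∈R′)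
            (deg≡0 C (λ v~u u∈C → v∉C (closedC u∈C v∈R′ (~-sym v~u))))
          where
          v∈R′ : v ∈ R′
          v∈R′ = ∖⁺ (∖⁺ (∁L⊆X (x∉p⇒x∈∁p v∉L)) v∉X′) (x≢y⇒x∉⁅y⁆ v≢d)
        go (no v≢d) (yes v∈L) with has-neighbour v
        ... | s , v~s with s ≟ᶠ d
        ... | yes refl = contradiction (leavesC v∈L v~s) v∉C
        ... | no  s≢d  = ≤-antisym
          (≤-trans (≤-reflexive (sym (deg-∪ v (λ u∈X′ u∈C → disjoint u∈C u∈X′)))) (deg-leaf v∈L (X′ ∪ C)))
          (≤-trans (deg≥1 v~s (D′⊆X′ (∖⁺ (support∈D v∈L v~s) (x≢y⇒x∉⁅y⁆ s≢d)))) (m≤m+n _ _))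

      -- X consists of X′, d and R′, so the union would be smaller than X, whose size is γ₁₁.
      no-smaller : ∀ {C} → Disjoint C X′ → ∣ C ∣ ≤ ∣ R′ ∣ → ¬ PerfectDominating T (X′ ∪ C)
      no-smaller {C} disjoint C≤R′ perfectP = contradiction
        (≤-trans (≤-reflexive (sym γ₁₁≡∣X∣)) (γ₁₁-minimal perfectP))
        (<⇒≱ (subst₂ _<_ (sym (∣∣-∪ (λ u∈X′ u∈C → disjoint u∈C u∈X′)))
          (sym (trans (∣∣-split X′⊆X) (cong (∣ X′ ∣ +_) (∣∖⁅⁆∣ d∈R))))
          (+-monoʳ-< ∣ X′ ∣ (s≤s C≤R′))))

      nonleaf∈R′ : ∀ {w} → d ~ w → w ∉ L → w ∈ R′
      nonleaf∈R′ d~w w∉L = ∖⁺ (∖⁺ (∁L⊆X (x∉p⇒x∈∁p w∉L)) (deg≡0⇒∉ deg-d≡0 d~w))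
        (x≢y⇒x∉⁅y⁆ λ w≡d → ~-irrefl (sym w≡d) d~w)

      -- The branch is the leaf ℓ alone. As d has no second leaf, w lies in R′, so R′ is large
      -- enough for `no-smaller`.
      pendant-impossible : ∀ {ℓ w} → ℓ ∈ L → d ~ ℓ → d ~ w → w ≢ ℓ → ⊥
      pendant-impossible {ℓ} {w} ℓ∈L d~ℓ d~w w≢ℓ = no-smaller disjoint small
          (smaller-perfect conn disjoint (λ d∈ → ~-irrefl (x∈⁅y⁆⇒x≡y ℓ d∈) d~ℓ) (x∈⁅x⁆ ℓ) d~ℓ closedC leavesC)
        where
        disjoint : Disjoint ⁅ ℓ ⁆ X′
        disjoint u∈ u∈X′ = deg≡0⇒∉ deg-d≡0 d~ℓ (subst (_∈ X′) (x∈⁅y⁆⇒x≡y ℓ u∈) u∈X′)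

        small : ∣ ⁅ ℓ ⁆ ∣ ≤ ∣ R′ ∣
        small = ≤-trans (≤-reflexive (∣⁅x⁆∣≡1 ℓ)) (nonempty⇒∣∣≥1 (nonleaf∈R′ d~w λ w∈L →
          w≢ℓ (deg≤1⇒unique {v = d} {L} d-weak d~w w∈L d~ℓ ℓ∈L)))

        conn : ConnectedSet T ⁅ ℓ ⁆
        conn = (ℓ , x∈⁅x⁆ ℓ) , λ u v u∈ v∈ →
          subst (Star (AdjacentWithin T ⁅ ℓ ⁆) u) (trans (x∈⁅y⁆⇒x≡y ℓ u∈) (sym (x∈⁅y⁆⇒x≡y ℓ v∈))) ε

        closedC : ∀ {u v} → u ∈ ⁅ ℓ ⁆ → v ∈ R′ → u ~ v → v ∈ ⁅ ℓ ⁆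
        closedC {u} {v} u∈ v∈R′ u~v = contradiction
          (subst (_∈ ⁅ d ⁆) (leaf-unique ℓ∈L (~-sym d~ℓ) (subst (_~ v) (x∈⁅y⁆⇒x≡y ℓ u∈) u~v)) (x∈⁅x⁆ d))
          (proj₂ (∖⁻ R ⁅ d ⁆ v∈R′))

        leavesC : ∀ {v} → v ∈ L → v ~ d → v ∈ ⁅ ℓ ⁆
        leavesC v∈L v~d = subst (_∈ ⁅ ℓ ⁆) (deg≤1⇒unique {v = d} {L} d-weak d~ℓ ℓ∈L (~-sym v~d) v∈L) (x∈⁅x⁆ ℓ)

      -- With no leaf at d, the branch is the component of R′ that contains the neighbour w.
      branch-impossible : (∀ {v} → v ∈ L → ¬ (d ~ v)) → ∀ {w C} → d ~ w → C ⊆ R′ → w ∈ C →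
                          ConnectedSet T C → ClosedWithin R′ C → ⊥
      branch-impossible none {C = C} d~w C⊆R′ w∈C conn closedC = no-smaller disjoint (p⊆q⇒∣p∣≤∣q∣ C⊆R′)
          (smaller-perfect conn disjoint (λ d∈C → proj₂ (∖⁻ R ⁅ d ⁆ (C⊆R′ d∈C)) (x∈⁅x⁆ d)) w∈C d~w closedC
            (λ v∈L v~d → contradiction (~-sym v~d) (none v∈L)))
        where
        disjoint : Disjoint C X′
        disjoint u∈C = proj₂ (∖⁻ X X′ (proj₁ (∖⁻ R ⁅ d ⁆ (C⊆R′ u∈C))))

      impossible : ⊥
      impossible with any? (λ v → (v ∈? L) ×-dec (d ~? v))
      ... | yes (ℓ , ℓ∈L , d~ℓ) =
        let (w , d~w , w≢ℓ) = nonleaf-other (leafless d∈D) ℓ in pendant-impossible ℓ∈L d~ℓ d~w w≢ℓ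
      ... | no none =
        let leafless-d        = λ {v} v∈L d~v → none (v , v∈L , d~v)
            (w , d~w)         = has-neighbour d
            (C , C⊆R′ , w∈C , conn , closedC , _) =
              component R′ w (nonleaf∈R′ d~w (λ w∈L → leafless-d w∈L d~w))
        in branch-impossible leafless-d d~w C⊆R′ w∈C conn closedC

    -- D = S, and the edge count of each component.

    D⊆S : D ⊆ S
    D⊆S {d} d∈D with d ∈? S
    ... | yes d∈S = d∈S
    ... | no  d∉S =
      let (X′ , D′⊆X′ , closed′ , count′ , least′) = closure (D ∖ ⁅ d ⁆) in
      ⊥-elim (Removal.impossible d∈D (≤-pred (≰⇒> (d∉S ∘ ∈-S⁺))) D′⊆X′ closed′ count′ least′)

    S⊆D : S ⊆ D
    S⊆D s∈S with deg≥1⇒neighbour L (≤-trans (s≤s z≤n) (∈-S⁻ s∈S))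
    ... | v , s~v , v∈L = support∈D v∈L (~-sym s~v)

    D≡S : D ≡ S
    D≡S = ⊆-antisym D⊆S S⊆D

    E-S≡0 : E S ≡ 0
    E-S≡0 = subst (λ A → E A ≡ 0) D≡S E-D≡0

    independentDominating : IndependentDominating T S
    independentDominating =
      (λ u v u∈S v∈S u~v → contradiction
        (subst (1 ≤_) E-S≡0 (≤-trans (deg≥1 u~v v∈S)
          (≤-trans (m≤m+n _ _) (≤-reflexive (sym (∑∈-⁅⁆-split S (λ w → deg w S) u∈S)))))) λ ()) ,
      subst (Dominating T) D≡S dom

    -- Closing X without Z restores Z at a gain of at least two edges per vertex. These edges meet Z
    -- and, Z being closed within W, their other ends lie in Z or S.
    weight≥ : ∀ {Z} → Z ⊆ W → ClosedWithin W Z → 4 * ∣ Z ∣ ≤ weight Z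
    weight≥ {Z} Z⊆W closedZ = arithmetic {E Y} {∣ X ∣} {E X} {∣ Y ∣} {∣ Z ∣} {edges Y Z} {E Z} {edges Z S}
        (reclosure D⊆Y (proj₁ ∘ ∖⁻ X Z)) (E-split Z⊆X) (∣∣-split Z⊆X)
        (trans (edges-comm Y Z) (trans (edges-splitʳ Z (D⊆Y ∘ S⊆D)) (cong (edges Z S +_) none)))
      where
      Y : Subset n
      Y = X ∖ Z

      Z⊆X : Z ⊆ X
      Z⊆X v∈Z = ∁L⊆X (x∉p⇒x∈∁p (W∩L≡∅ (Z⊆W v∈Z)))

      D⊆Y : D ⊆ Y
      D⊆Y v∈D = ∖⁺ (D⊆X v∈D) (λ v∈Z → W∩S≡∅ (Z⊆W v∈Z) (D⊆S v∈D))

      none : edges Z (Y ∖ S) ≡ 0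
      none = edges≡0 Z (Y ∖ S) λ u∈Z v∈ u~v → case ∖⁻ Y S v∈ of λ (v∈Y , v∉S) → case ∖⁻ X Z v∈Y of λ
        (v∈X , v∉Z) → v∉Z (closedZ u∈Z (∈-W⁺ v∉S (x∈∁p⇒x∉p (X⊆∁L v∈X))) u~v)

      arithmetic : ∀ {eY x eX y z s eZ t} → eY + 4 * x ≤ eX + 4 * y → eX ≡ eZ + 2 * s + eY → x ≡ z + y →
                   s ≡ t + 0 → 4 * z ≤ eZ + 2 * t
      arithmetic {eY} {y = y} {z} {eZ = eZ} {t} h refl refl refl =
        linear _ _ h (≤-reflexive (regroup eY y z eZ t))
        where
        regroup : ∀ e y z f t → 4 * z + (f + 2 * (t + 0) + e + 4 * y) ≡ f + 2 * t + (e + 4 * (z + y))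
        regroup = solve-∀

    -- The forest on X has at most |X| - 1 edges, and |X| = 2|S| - 1 = |S| + |W| makes this 2|W|.
    weight-W : weight W ≤ 4 * ∣ W ∣
    weight-W = arithmetic {E (∁ L)} {weight W} {∣ ∁ L ∣} {∣ S ∣} {∣ W ∣}
      (subst (λ A → E A + 2 ≤ 2 * ∣ A ∣) X≡∁L forest-X) (nonleaf-weight E-S≡0)
      (subst₂ (λ A B → ∣ A ∣ + 1 ≡ 2 * ∣ B ∣) X≡∁L D≡S ∣X∣+1≡2∣D∣) ∣∁L∣≡
      where
      arithmetic : ∀ {e f x s w} → e + 2 ≤ 2 * x → e ≡ f → x + 1 ≡ 2 * s → x ≡ s + w → f ≤ 4 * w
      arithmetic {e} {s = s} {w} h refl eq refl =
        linear _ _ (+-mono-≤ h (*-monoʳ-≤ 2 (≤-reflexive (sym eq)))) (≤-reflexive (regroup e s w))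
        where
        regroup : ∀ e s w → e + (2 * (s + w) + 2 * (s + w + 1)) ≡ 4 * w + (e + 2 + 2 * (2 * s))
        regroup = solve-∀

    componentCount : ∀ C → IsRemainingComponent T C → ComponentCount T C
    componentCount C isC@(C⊆W , conn , _) = trans (∣N∩S∣≡edges C⊆W conn)
      -- The lower bounds for C and for the rest of W add up to the upper bound for W, so `weight C`
      -- is exactly 4|C|. The tree on C accounts for 2|C| - 2 of it, leaving |C| + 1 edges to S.
      (arithmetic {weight W} {∣ W ∣} {weight (W ∖ C)} {∣ C ∣} {∣ W ∖ C ∣} {E C} {edges C S}
        weight-W (weight-split C⊆W closedC) (∣∣-split C⊆W) (weight≥ C⊆W closedC)
        (weight≥ (proj₁ ∘ ∖⁻ W C) (∖-closed (λ _ v∈W _ → v∈W) closedC))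
        (forest-edges C (proj₁ conn)) (connected⇒edges conn))
      where
      closedC : ClosedWithin W C
      closedC = component⇒closed isC

      arithmetic : ∀ {fW w fR c r e s} → fW ≤ 4 * w → fW ≡ e + 2 * s + fR → w ≡ c + r → 4 * c ≤ e + 2 * s →
                   4 * r ≤ fR → e + 2 ≤ 2 * c → 2 * c ≤ e + 2 → s ≡ c + 1
      arithmetic {fR = fR} {c} {r} {e} {s} h refl refl hC hR h₁ h₂ = ≤-antisym
        (*-cancelˡ-≤ 2 (linear (2 * s) (2 * (c + 1)) (+-mono-≤ h (+-mono-≤ hR h₂)) (≤-reflexive (upper fR c r e s))))
        (*-cancelˡ-≤ 2 (linear (2 * (c + 1)) (2 * s) (+-mono-≤ hC h₁) (≤-reflexive (lower c e s))))
        where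
        upper : ∀ f c r e s → 2 * s + (4 * (c + r) + (f + (e + 2))) ≡
                2 * (c + 1) + (e + 2 * s + f + (4 * r + 2 * c))
        upper = solve-∀
        lower : ∀ c e s → 2 * (c + 1) + (e + 2 * s + 2 * c) ≡ 2 * s + (4 * c + (e + 2))
        lower = solve-∀

  extremal⇒conditions : γ₁₁ T + 1 ≡ 2 * γ T →
    IndependentDominating T S × (∀ C → IsRemainingComponent T C → ComponentCount T C)
  extremal⇒conditions extremal with minimum-leafless
  ... | D , dom , leafless , ∣D∣≡γ with closure D
  ... | X , D⊆X , closed , count , least = independentDominating , componentCount
    where open Extremal extremal dom leafless ∣D∣≡γ D⊆X closed count least

theorem3 : ∀ {n} (T : Graph n) → IsTree T → 3 ≤ n →
    (γ₁₁ T ≡ 2 * γ T ∸ 1 ⇔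
    (IndependentDominating T (strongSupports T)
    × (∀ C → IsRemainingComponent T C → ComponentCount T C)))
    × (IndependentDominating T (strongSupports T) →
    ∀ C → IsRemainingComponent T C →
    (ComponentCount T C ⇔ OneDoublyDominated T C))
theorem3 T tree 3≤n = mk⇔ to from , λ (_ , dom) → count⇔oneDoubly dom
  where
  open Tree T tree 3≤n

  -- This makes the truncated subtraction in `2 * γ T ∸ 1` a true one.
  1≤2γ : 1 ≤ 2 * γ T
  1≤2γ = ≤-trans γ≥1 (m≤m+n (γ T) _)

  to : γ₁₁ T ≡ 2 * γ T ∸ 1 → IndependentDominating T S × (∀ C → IsRemainingComponent T C → ComponentCount T C)
  to eq = extremal⇒conditions (trans (cong (_+ 1) eq) (m∸n+n≡m 1≤2γ))

  from : IndependentDominating T S × (∀ C → IsRemainingComponent T C → ComponentCount T C) → γ₁₁ T ≡ 2 * γ T ∸ 1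
  from (indepDom , counts) = sym (trans
    (cong (_∸ 1) (≤-antisym (conditions⇒2γ≤γ₁₁+1 indepDom counts) γ₁₁<2γ)) (m+n∸n≡m (γ₁₁ T) 1))
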